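{- Let $k\ge 2$ be an integer. For each positive integer $m$, let $\mathcal{C}_m$ denote the family of $m$-critical $(P_5,\overline{P}_5)$-free graphs. A graph $G$ belongs to $\mathcal{C}_k$ if and only if it can be obtained by one of the following two constructions: (1) $G$ is the join of a member of $\mathcal{C}_{k_1}$ and a member of $\mathcal{C}_{k_2}$, for some positive integers $k_1,k_2$ with $k_1+k_2=k$; (2) $G$ is a buoy with bags $B_1,\ldots,B_5$ such that, for each $i$ (indices mod $5$), the graph $B_i$ is a member of $\mathcal{C}_{k_i}$, where $k_1,\ldots,k_5$ are positive integers satisfying $k_i+k_{i+1}\le k-1$ for each $i \bmod 5$ and $\sum_{i=1}^5 k_i=2k-1$.
   Context: All graphs are finite and simple. A graph is $(P_5,\overline{P}_5)$-free if it contains no induced subgraph isomorphic to the path $P_5$ on five vertices or to its complement $\overline{P}_5$. A graph is $k$-critical if its chromatic number is $k$ and every proper induced subgraph is $(k-1)$-colorable. The join of graphs $G$ and $H$ is obtained from disjoint copies of $G$ and $H$ by adding all edges between a vertex of $G$ and a vertex of $H$. A buoy is a graph obtained from the $5$-cycle $C_5$ on vertices $x_1,\ldots,x_5$ (in cyclic order) by replacing each $x_i$ by a nonempty graph $B_i$ (the bags), where two vertices in different bags $B_i,B_j$ are adjacent if and only if $x_ix_j$ is an edge of the $C_5$ (i.e. $j=i\pm 1 \bmod 5$), and edges inside each $B_i$ are those of $B_i$. -}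

module Defs where

open import Data.Nat using (ℕ; zero; suc; _+_; _∸_; _≤_; _<_; _*_)
open import Data.Bool using (Bool; true; false; _∨_; _∧_; not; if_then_else_)
open import Data.Fin using (Fin; toℕ; _≟_; splitAt) renaming (zero to f0; suc to fs)
open import Data.Product using (Σ; _×_; _,_; ∃; ∃-syntax)
open import Data.Sum using (_⊎_; inj₁; inj₂)
open import Relation.Nullary using (¬_; does; yes; no)
open import Relation.Binary.PropositionalEquality using (_≡_; _≢_; refl; sym; trans; cong)
open import Function.Definitions using (Injective)
open import Function.Bundles using (_↔_; Inverse)

record Graph : Set where
  field
    size  : ℕ
    adj   : Fin size → Fin size → Bool
    adj-sym   : ∀ i j → adj i j ≡ adj j i
    adj-irr   : ∀ i → adj i i ≡ false
open Graph public

induced : (G : Graph) {m : ℕ} → (Fin m → Fin (size G)) → Graph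
induced G {m} f = record
  { size = m
  ; adj = λ i j → adj G (f i) (f j)
  ; adj-sym = λ i j → adj-sym G (f i) (f j)
  ; adj-irr = λ i → adj-irr G (f i)
  }

ContainsInduced : Graph → Graph → Set
ContainsInduced G H =
  Σ (Fin (size H) → Fin (size G)) λ f →
    Injective _≡_ _≡_ f × (∀ i j → adj H i j ≡ adj G (f i) (f j))

pathAdj : ℕ → ℕ → Bool
pathAdj zero (suc zero) = true
pathAdj (suc zero) zero = true
pathAdj (suc m) (suc n) = pathAdj m n
pathAdj _ _ = false

pathAdj-sym : ∀ m n → pathAdj m n ≡ pathAdj n m
pathAdj-sym zero zero = refl
pathAdj-sym zero (suc zero) = refl
pathAdj-sym zero (suc (suc n)) = refl
pathAdj-sym (suc zero) zero = refl
pathAdj-sym (suc (suc m)) zero = refl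
pathAdj-sym (suc zero) (suc zero) = refl
pathAdj-sym (suc zero) (suc (suc n)) = pathAdj-sym zero (suc n)
pathAdj-sym (suc (suc m)) (suc zero) = pathAdj-sym (suc m) zero
pathAdj-sym (suc (suc m)) (suc (suc n)) = pathAdj-sym (suc m) (suc n)

pathAdj-irr : ∀ m → pathAdj m m ≡ false
pathAdj-irr zero = refl
pathAdj-irr (suc zero) = refl
pathAdj-irr (suc (suc m)) = pathAdj-irr (suc m)

P : ℕ → Graph
P n = record
  { size = n
  ; adj = λ i j → pathAdj (toℕ i) (toℕ j)
  ; adj-sym = λ i j → pathAdj-sym (toℕ i) (toℕ j)
  ; adj-irr = λ i → pathAdj-irr (toℕ i)
  }

P5 : Graph
P5 = P 5

complement : Graph → Graph
complement G = record
  { size = size G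
  ; adj = cadj
  ; adj-sym = csym
  ; adj-irr = cirr
  }
  where
  cadj : Fin (size G) → Fin (size G) → Bool
  cadj i j with i ≟ j
  ... | yes _ = false
  ... | no _ = not (adj G i j)

  csym : ∀ i j → cadj i j ≡ cadj j i
  csym i j with i ≟ j | j ≟ i
  ... | yes _ | yes _ = refl
  ... | yes p | no q = Data.Empty.⊥-elim (q (sym p))
    where import Data.Empty
  ... | no p | yes q = Data.Empty.⊥-elim (p (sym q))
    where import Data.Empty
  ... | no _ | no _ = cong not (adj-sym G i j)

  cirr : ∀ i → cadj i i ≡ false
  cirr i with i ≟ i
  ... | yes _ = refl
  ... | no p = Data.Empty.⊥-elim (p refl)
    where import Data.Empty

coP5 : Graph
coP5 = complement P5

P5coP5Free : Graph → Set
P5coP5Free G = ¬ ContainsInduced G P5 × ¬ ContainsInduced G coP5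

Colorable : ℕ → Graph → Set
Colorable c G =
  Σ (Fin (size G) → Fin c) λ col →
    ∀ i j → adj G i j ≡ true → col i ≢ col j

HasChromaticNumber : ℕ → Graph → Set
HasChromaticNumber k G = Colorable k G × (∀ c → c < k → ¬ Colorable c G)

Critical : ℕ → Graph → Set
Critical k G =
  HasChromaticNumber k G ×
  (∀ (m : ℕ) (f : Fin m → Fin (size G)) → Injective _≡_ _≡_ f → m < size G →
     Colorable (k ∸ 1) (induced G f))

InC : ℕ → Graph → Set
InC m G = Critical m G × P5coP5Free G

joinAdj : (H₁ H₂ : Graph) → Fin (size H₁) ⊎ Fin (size H₂) → Fin (size H₁) ⊎ Fin (size H₂) → Bool
joinAdj H₁ H₂ (inj₁ a) (inj₁ b) = adj H₁ a b
joinAdj H₁ H₂ (inj₂ a) (inj₂ b) = adj H₂ a b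
joinAdj H₁ H₂ (inj₁ _) (inj₂ _) = true
joinAdj H₁ H₂ (inj₂ _) (inj₁ _) = true

IsJoin : Graph → Graph → Graph → Set
IsJoin G H₁ H₂ =
  Σ (Fin (size G) ↔ (Fin (size H₁) ⊎ Fin (size H₂))) λ φ →
    ∀ u v → adj G u v ≡ joinAdj H₁ H₂ (Inverse.to φ u) (Inverse.to φ v)

c5Adj : Fin 5 → Fin 5 → Bool
c5Adj i j = pathAdj (toℕ i) (toℕ j)
  ∨ (does (toℕ i Data.Nat.≟ 0) ∧ does (toℕ j Data.Nat.≟ 4))
  ∨ (does (toℕ i Data.Nat.≟ 4) ∧ does (toℕ j Data.Nat.≟ 0))
  where import Data.Nat

next : Fin 5 → Fin 5
next f0 = fs f0
next (fs f0) = fs (fs f0)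
next (fs (fs f0)) = fs (fs (fs f0))
next (fs (fs (fs f0))) = fs (fs (fs (fs f0)))
next (fs (fs (fs (fs f0)))) = f0

BuoyVertex : (Fin 5 → Graph) → Set
BuoyVertex B = Σ (Fin 5) λ i → Fin (size (B i))

buoyAdj : (B : Fin 5 → Graph) → BuoyVertex B → BuoyVertex B → Bool
buoyAdj B (i , a) (j , b) with i ≟ j
... | yes refl = adj (B i) a b
... | no _ = c5Adj i j

IsBuoy : Graph → (Fin 5 → Graph) → Set
IsBuoy G B =
  (∀ i → 1 ≤ size (B i)) ×
  Σ (Fin (size G) ↔ BuoyVertex B) λ φ →
    ∀ u v → adj G u v ≡ buoyAdj B (Inverse.to φ u) (Inverse.to φ v)

sum5 : (Fin 5 → ℕ) → ℕ
sum5 f = f f0 + f (fs f0) + f (fs (fs f0)) + f (fs (fs (fs f0))) + f (fs (fs (fs (fs f0))))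

JoinConstruction : ℕ → Graph → Set
JoinConstruction k G =
  Σ ℕ λ k₁ → Σ ℕ λ k₂ → 1 ≤ k₁ × 1 ≤ k₂ × k₁ + k₂ ≡ k ×
  Σ Graph λ H₁ → Σ Graph λ H₂ → InC k₁ H₁ × InC k₂ H₂ × IsJoin G H₁ H₂

BuoyConstruction : ℕ → Graph → Set
BuoyConstruction k G =
  Σ (Fin 5 → ℕ) λ ks → Σ (Fin 5 → Graph) λ B →
    (∀ i → 1 ≤ ks i) ×
    (∀ i → InC (ks i) (B i)) ×
    (∀ i → ks i + ks (next i) ≤ k ∸ 1) ×
    sum5 ks ≡ 2 * k ∸ 1 ×
    IsBuoy G B

{-# OPTIONS --safe #-}
-- Sufficiency: a join or a 5-cycle composition of (P5, co-P5)-free graphs is again free because P5 and its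
-- complement are prime and not contained in C5, and its chromatic number is found by giving colour sets to
-- the parts; a C5 with weights a i has a K-colouring as soon as a i + a (i + 1) ≤ K and the sum is ≤ 2 K,
-- and needs sum ≤ 2 K since a colour occurs in at most two bags.
--
-- Necessity: every vertex is complete or anticomplete to an induced C5, or looks like one of its vertices.
-- The vertices of the last kind form a buoy, and they form a module. If that buoy is never the whole graph,
-- contracting it and repeating ends with a C5-free quotient by at least two modules. There the order by
-- nonincreasing degree is perfect in Chvátal's sense, also after replacing each module by a clique on as many
-- vertices as it needs colours. So as many colours as G needs are already needed by pairwise complete
-- modules, which are all of G by criticality: G is a join. Finally, modules of critical graphs are critical.
module Submission where

open import Defs hiding (P)
import Data.Bool as Bool
open import Data.Bool using (Bool; true; false)
open import Data.Empty using (⊥; ⊥-elim)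
open import Data.Fin using (Fin; toℕ; fromℕ<; punchIn; punchOut; inject≤; _≟_)
  renaming (zero to f0; suc to fs)
open import Data.Fin.Properties using
  ( any?; all?; toℕ<n; toℕ-injective; toℕ-fromℕ<; toℕ-inject≤; injective⇒≤; <⇒notInjective
  ; punchIn-injective; punchInᵢ≢i; punchIn-punchOut; ¬∀⟶∃¬; suc-injective; 0≢1+n )
open import Data.List using (List; []; _∷_; concatMap; map; upTo; allFin)
import Data.List.Membership.DecPropositional as DecMembership
open import Data.List.Membership.Propositional using (_∈_; find; lose)
open import Data.List.Membership.Propositional.Properties using
  (∈-concatMap⁺; ∈-concatMap⁻; ∈-map⁺; ∈-map⁻; ∈-upTo⁺; ∈-upTo⁻; ∈-allFin)
open import Data.List.Relation.Binary.Permutation.Propositional using (↭-sym)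
open import Data.List.Relation.Binary.Permutation.Propositional.Properties using (∈-resp-↭)
import Data.List.Relation.Unary.All as All
open import Data.List.Relation.Unary.AllPairs using (AllPairs; []; _∷_)
open import Data.List.Relation.Unary.Any as Any using (here; there)
open import Data.List.Relation.Unary.Linked.Properties using (Linked⇒AllPairs)
import Data.List.Sort as Sort
import Data.Nat as ℕ
open import Data.Nat using (ℕ; zero; suc; _+_; _∸_; _*_; _⊓_; _⊔_; _≤_; _<_; z≤n; s≤s; s<s)
open import Data.Nat.Induction using (<-wellFounded)
open import Data.Nat.Properties using
  ( ≤-refl; ≤-reflexive; ≤-trans; ≤-antisym; ≤-pred; <-irrefl; <-trans; <-≤-trans; ≤-<-trans; <⇒≤; <⇒≤pred; <⇒≱
  ; ≰⇒>; ≮⇒≥; n<1+n; n≤1+n; m≤m+n; m≤n+m; +-comm; +-assoc; +-suc; +-identityʳ; +-mono-≤; +-mono-<-≤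
  ; +-mono-≤-<; +-monoʳ-<; +-monoˡ-≤; +-monoʳ-≤; +-cancelˡ-≡; +-cancelʳ-≤; +-cancelʳ-<; m∸n+n≡m; m∸n≤m
  ; m⊓n≤m; m⊓n≤n; m≤m⊔n; m≤n⊔m; ⊓-sel; ⊔-sel; _<?_; _≤?_; ≤-decTotalOrder; +-0-commutativeMonoid
  ; module ≤-Reasoning )
open import Algebra.Properties.CommutativeMonoid.Sum +-0-commutativeMonoid
  using (sum; ∑-distrib-+; ∑-comm; sum-cong-≗)
open import Data.Nat.Solver using (module +-*-Solver)
open import Data.Product using (Σ; ∃; _×_; _,_; proj₁; proj₂)
open import Data.Product.Properties using (≡-dec)
open import Data.Sum using (_⊎_; inj₁; inj₂; [_,_]′)
open import Data.Unit using (⊤; tt)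
open import Data.Vec.Functional using () renaming (_∷_ to _◂_; [] to ⟨⟩)
open import Function using (_∘_; id; mk⇔; mk↔ₛ′)
open import Function.Bundles using (_⇔_; Inverse)
open import Function.Definitions using (Injective)
open import Induction.WellFounded using (Acc; acc)
open import Relation.Binary.Definitions using (DecidableEquality)
import Relation.Binary.Construct.On as On
open import Relation.Binary.PropositionalEquality using
  (_≡_; _≢_; _≗_; refl; sym; trans; cong; cong₂; subst; subst₂; ≢-sym)
open import Relation.Nullary using (¬_; Dec; yes; no; does; contradiction)
open import Relation.Nullary.Decidable using
  (_×-dec_; _⊎-dec_; _→-dec_; ¬?; map′; from-yes; decidable-stable; dec-true; dec-false)
open import Relation.Unary using (Decidable)

-- The degree order replaces any appeal to the theory of perfect graphs. In a P4 `a b c d` of the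
-- C5-free quotient every neighbour of an end sees a middle vertex and every common neighbour of the
-- ends sees both, so degree a + degree d < degree b + degree c. Hence `a` and `d` cannot both come
-- before their neighbours `b` and `c`, which is Chvátal's obstruction, and strictness makes ties
-- harmless. Clique copies of a vertex are true twins, so an obstruction among copies is one among
-- their originals: degrees in the unweighted quotient order the weighted one as well.
--
-- The constants of a buoy come from parity. Since a colour serves at most two bags, 2k - 1 is the
-- smallest total that defeats k - 1 colours, and the loss of one vertex brings it down to 2(k - 1),
-- where the cyclic palettes fit.
--
-- One device carries all lower bounds and recolourings: a set that needs w colours shows at least w
-- of them in every colouring of any larger set.

pattern f1 = fs f0
pattern f2 = fs f1
pattern f3 = fs f2
pattern f4 = fs f3

-- Sums, counting and search over finite types

∑-mono-≤ : ∀ {n} {f g : Fin n → ℕ} → (∀ i → f i ≤ g i) → sum f ≤ sum g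
∑-mono-≤ {zero}  f≤g = z≤n
∑-mono-≤ {suc n} f≤g = +-mono-≤ (f≤g f0) (∑-mono-≤ (f≤g ∘ fs))

∑-mono-< : ∀ {n} {f g : Fin n → ℕ} → (∀ i → f i ≤ g i) → ∀ i → f i < g i → sum f < sum g
∑-mono-< f≤g f0     lt = +-mono-<-≤ lt (∑-mono-≤ (f≤g ∘ fs))
∑-mono-< f≤g (fs i) lt = +-mono-≤-< (f≤g f0) (∑-mono-< (f≤g ∘ fs) i lt)

∑-bound : ∀ {n} {f : Fin n → ℕ} b → (∀ i → f i ≤ b) → sum f ≤ n * b
∑-bound {zero}  b f≤b = z≤n
∑-bound {suc n} b f≤b = +-mono-≤ (f≤b f0) (∑-bound b (f≤b ∘ fs))

ind : {A : Set} → Dec A → ℕ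
ind (yes _) = 1
ind (no  _) = 0

ind-mono : {A B : Set} {A? : Dec A} {B? : Dec B} → (A → B) → ind A? ≤ ind B?
ind-mono {A? = yes a} {yes b} f = ≤-refl
ind-mono {A? = yes a} {no ¬b} f = contradiction (f a) ¬b
ind-mono {A? = no ¬a}         f = z≤n

count : ∀ {n} {P : Fin n → Set} → Decidable P → ℕ
count P? = sum (λ i → ind (P? i))

count-mono-< : ∀ {n} {P Q : Fin n → Set} (P? : Decidable P) (Q? : Decidable Q) →
  (∀ i → P i → Q i) → ∀ i → Q i → ¬ P i → count P? < count Q?
count-mono-< P? Q? P⊆Q i q ¬p = ∑-mono-< (λ j → ind-mono (P⊆Q j)) i strict
  where
  strict : ind (P? i) < ind (Q? i)
  strict with P? i | Q? i
  ... | yes p | _     = contradiction p ¬p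
  ... | no _  | yes _ = ≤-refl
  ... | no _  | no ¬q = contradiction q ¬q

record Enumeration {n} (P : Fin n → Set) (s : ℕ) : Set where
  field
    at       : Fin s → Fin n
    at-inj   : Injective _≡_ _≡_ at
    at-sound : ∀ i → P (at i)
    index    : ∀ {x} → P x → Fin s
    at-index : ∀ {x} (p : P x) → at (index p) ≡ x

  index-inj : ∀ {x y} (p : P x) (q : P y) → index p ≡ index q → x ≡ y
  index-inj p q eq = trans (sym (at-index p)) (trans (cong at eq) (at-index q))

enumerate : ∀ {n} {P : Fin n → Set} (P? : Decidable P) → Enumeration P (count P?)
enumerate {zero} P? = record
  { at = λ (); at-inj = λ { {()} }; at-sound = λ (); index = λ { {()} }; at-index = λ { {()} } }
enumerate {suc n} {P} P? with P? f0
... | yes p = record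
  { at       = f0 ◂ (fs ∘ at)
  ; at-inj   = λ { {f0} {f0} _ → refl ; {fs i} {fs j} eq → cong fs (at-inj (suc-injective eq)) }
  ; at-sound = λ { f0 → p ; (fs i) → at-sound i }
  ; index    = λ { {f0} _ → f0 ; {fs x} q → fs (index q) }
  ; at-index = λ { {f0} _ → refl ; {fs x} q → cong fs (at-index q) }
  }
  where open Enumeration (enumerate (P? ∘ fs))
... | no ¬p = record
  { at       = fs ∘ at
  ; at-inj   = λ eq → at-inj (suc-injective eq)
  ; at-sound = at-sound
  ; index    = λ { {f0} q → contradiction q ¬p ; {fs x} q → index q }
  ; at-index = λ { {f0} q → contradiction q ¬p ; {fs x} q → cong fs (at-index q) }
  }
  where open Enumeration (enumerate (P? ∘ fs))

-- Pointwise equal functions need not be equal, so `ext` is what lets the search through the tables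
-- `x ◂ f` reach every function.
∃function? : ∀ m {c} {P : (Fin m → Fin c) → Set} → (∀ {f g} → f ≗ g → P f → P g) → Decidable P → Dec (∃ P)
∃function? zero {c} {P} ext P? =
  map′ (λ p → ⟨⟩ , p) (λ (f , p) → ext (λ ()) p) (P? ⟨⟩)
∃function? (suc m) {c} {P} ext P? =
  map′ (λ (x , f , p) → (x ◂ f) , p)
       (λ (f , p) → f f0 , f ∘ fs , ext (λ { f0 → refl ; (fs _) → refl }) p)
       (any? (λ x → ∃function? m (λ f≗g → ext λ { f0 → refl ; (fs i) → f≗g i }) (λ f → P? (x ◂ f))))

least : {P : ℕ → Set} → Decidable P → ∀ n → P n → Σ ℕ λ m → P m × (∀ c → c < m → ¬ P c)
least P? n p with P? 0
least P? n       p | yes q = 0 , q , λ _ ()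
least P? zero    p | no ¬q = contradiction p ¬q
least P? (suc n) p | no ¬q =
  let m , pm , below = least (P? ∘ suc) n p
  in suc m , pm , λ { zero _ → ¬q ; (suc c) (s≤s c<m) → below c c<m }

missed : ∀ {m n} (f : Fin m → Fin n) → m < n → ∃ λ x → ∀ j → f j ≢ x
missed {m} {n} f m<n with all? (λ x → any? (λ j → f j ≟ x))
... | yes hit = ⊥-elim (<⇒notInjective {f = proj₁ ∘ hit} m<n sec-inj)
  where
  sec-inj : Injective _≡_ _≡_ (proj₁ ∘ hit)
  sec-inj {x} {y} eq = trans (sym (proj₂ (hit x))) (trans (cong f eq) (proj₂ (hit y)))
... | no ¬hit with x , ¬h ← ¬∀⟶∃¬ n _ (λ x → any? (λ j → f j ≟ x)) ¬hit = x , λ j eq → ¬h (j , eq)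

record Deletion {n} (x : Fin n) : Set where
  field
    {m}    : ℕ
    m<n    : m < n
    incl   : Fin m → Fin n
    incl-inj : Injective _≡_ _≡_ incl
    incl-≢ : ∀ j → incl j ≢ x
    onto   : ∀ {y} → y ≢ x → ∃ λ j → incl j ≡ y

deletion : ∀ {n} (x : Fin n) → Deletion x
deletion {suc n} x = record
  { m<n = n<1+n n
  ; incl = punchIn x
  ; incl-inj = punchIn-injective x _ _
  ; incl-≢ = punchInᵢ≢i x
  ; onto = λ y≢x → punchOut (≢-sym y≢x) , punchIn-punchOut (≢-sym y≢x)
  }

-- Colourings and criticality of vertex subsets

Colorable? : ∀ H c → Dec (Colorable c H)
Colorable? H c = ∃function? (size H)
  (λ f≗g proper i j ij eq → proper i j ij (trans (f≗g i) (trans eq (sym (f≗g j)))))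
  (λ f → all? λ i → all? λ j → (adj H i j Bool.≟ true) →-dec ¬? (f i ≟ f j))

module Colouring (G : Graph) where

  V : Set
  V = Fin (size G)

  ColOn : (V → Set) → ℕ → Set
  ColOn P c = Σ (V → ℕ) λ col →
    (∀ v → P v → col v < c) ×
    (∀ u v → P u → P v → adj G u v ≡ true → col u ≢ col v)

  Needs : (V → Set) → ℕ → Set
  Needs P w = ∀ c → c < w → ¬ ColOn P c

  _−_ : (V → Set) → V → (V → Set)
  (P − x) v = P v × v ≢ x

  -- Deleting single vertices is enough, because a proper induced subgraph misses some vertex. All
  -- subsets live in one graph with colourings total on `V`, so nothing is reindexed when a vertex
  -- or a module is removed.
  CritOn : (V → Set) → ℕ → Set
  CritOn P k = ColOn P k × Needs P k × (∀ x → P x → ColOn (P − x) (k ∸ 1))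

  All : V → Set
  All _ = ⊤

  ColOn-⊆ : ∀ {P Q c} → (∀ v → P v → Q v) → ColOn Q c → ColOn P c
  ColOn-⊆ P⊆Q (col , bound , proper) =
    col , (λ v p → bound v (P⊆Q v p)) , (λ u v p q → proper u v (P⊆Q u p) (P⊆Q v q))

  ColOn-≤ : ∀ {P c d} → c ≤ d → ColOn P c → ColOn P d
  ColOn-≤ c≤d (col , bound , proper) = col , (λ v p → <-≤-trans (bound v p) c≤d) , proper

  module Extend {P : V → Set} (P? : Decidable P) (f : ∀ v → P v → ℕ) where
    extend : V → ℕ
    extend v with P? v
    ... | yes p = f v p
    ... | no _  = 0

    -- `f` may depend on the proof of `P v`, so the value is described with the proof that the
    -- decision procedure found.
    extend-on : ∀ v → P v → Σ (P v) λ p → extend v ≡ f v p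
    extend-on v p with P? v
    ... | yes q = q , refl
    ... | no ¬p = contradiction p ¬p

  record Embedding (H : Graph) (P : V → Set) : Set where
    field
      emb      : Fin (size H) → V
      emb-inj  : Injective _≡_ _≡_ emb
      emb-adj  : ∀ i j → adj H i j ≡ adj G (emb i) (emb j)
      emb-in   : ∀ i → P (emb i)
      back     : ∀ {v} → P v → Fin (size H)
      emb-back : ∀ {v} (p : P v) → emb (back p) ≡ v

  open Embedding

  part : ∀ {P} → Decidable P → Graph
  part P? = induced G (Enumeration.at (enumerate P?))

  part-embedding : ∀ {P} (P? : Decidable P) → Embedding (part P?) P
  part-embedding P? = record
    { emb = at ; emb-inj = at-inj ; emb-adj = λ _ _ → refl ; emb-in = at-sound
    ; back = index ; emb-back = at-index }
    where open Enumeration (enumerate P?)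

  self-embedding : Embedding G All
  self-embedding = record
    { emb = id ; emb-inj = id ; emb-adj = λ _ _ → refl ; emb-in = λ _ → tt
    ; back = λ {v} _ → v ; emb-back = λ _ → refl }

  Embedding-∘ : ∀ {H P F} → Embedding H P → ContainsInduced H F → ContainsInduced G F
  Embedding-∘ E (f , f-inj , f-adj) =
    emb E ∘ f , (f-inj ∘ emb-inj E) , λ i j → trans (f-adj i j) (emb-adj E (f i) (f j))

  Embedding-free : ∀ {H P} → Embedding H P → P5coP5Free G → P5coP5Free H
  Embedding-free E (free₁ , free₂) = free₁ ∘ Embedding-∘ {F = P5} E , free₂ ∘ Embedding-∘ {F = coP5} E

  module _ {H P} (E : Embedding H P) where

    ColOn⇒Colorable : ∀ {c} → ColOn P c → Colorable c H
    ColOn⇒Colorable (col , bound , proper) =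
      (λ i → fromℕ< (bound (emb E i) (emb-in E i))) ,
      λ i j ij eq → proper _ _ (emb-in E i) (emb-in E j) (trans (sym (emb-adj E i j)) ij)
        (trans (sym (toℕ-fromℕ< _)) (trans (cong toℕ eq) (toℕ-fromℕ< _)))

    Colorable⇒ColOn : ∀ {c} → Decidable P → Colorable c H → ColOn P c
    Colorable⇒ColOn {c} P? (col , proper) = extend , bound′ , proper′
      where
      open Extend P? (λ v p → toℕ (col (back E p)))
      bound′ : ∀ v → P v → extend v < c
      bound′ v p with extend-on v p
      ... | q , eq = subst (_< c) (sym eq) (toℕ<n _)
      proper′ : ∀ u v → P u → P v → adj G u v ≡ true → extend u ≢ extend v
      proper′ u v p q uv eq with extend-on u p | extend-on v q
      ... | p′ , eu | q′ , ev = proper (back E p′) (back E q′)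
        (trans (emb-adj E _ _) (trans (cong₂ (adj G) (emb-back E p′) (emb-back E q′)) uv))
        (toℕ-injective (trans (sym eu) (trans eq ev)))

  ColOn? : ∀ {P} → Decidable P → ∀ c → Dec (ColOn P c)
  ColOn? P? c = map′ (Colorable⇒ColOn (part-embedding P?) P?) (ColOn⇒Colorable (part-embedding P?))
    (Colorable? (part P?) c)

  chromatic : ∀ {P} → Decidable P → Σ ℕ λ w → ColOn P w × Needs P w
  chromatic P? = least (ColOn? P?) (size G)
    (toℕ , (λ v _ → toℕ<n v) , λ u v _ _ uv eq → loop (toℕ-injective eq) uv)
    where
    loop : ∀ {u v} → u ≡ v → adj G u v ≢ true
    loop refl uv with () ← trans (sym uv) (adj-irr G _)

  Critical⇒CritOn : ∀ {H P k} → Decidable P → Embedding H P → Critical k H → CritOn P k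
  Critical⇒CritOn {H} {P} {k} P? E ((colourable , minimal) , critical) =
    Colorable⇒ColOn E P? colourable ,
    (λ c c<k → minimal c c<k ∘ ColOn⇒Colorable E) ,
    λ x p → Colorable⇒ColOn (delete p)
      (λ v → P? v ×-dec ¬? (v ≟ x))
      (critical _ (Deletion.incl (del p)) (Deletion.incl-inj (del p)) (Deletion.m<n (del p)))
    where
    del : ∀ {x} (p : P x) → Deletion (back E p)
    del p = deletion (back E p)
    delete : ∀ {x} (p : P x) → Embedding (induced H (Deletion.incl (del p))) (P − x)
    delete {x} p = record
      { emb      = emb E ∘ incl
      ; emb-inj  = incl-inj ∘ emb-inj E
      ; emb-adj  = λ i j → emb-adj E (incl i) (incl j)
      ; emb-in   = λ i → emb-in E (incl i) , λ eq → incl-≢ i (emb-inj E (trans eq (sym (emb-back E p))))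
      ; back     = λ (q , v≢x) → proj₁ (onto (avoid q v≢x))
      ; emb-back = λ (q , v≢x) → trans (cong (emb E) (proj₂ (onto (avoid q v≢x)))) (emb-back E q)
      }
      where
      open Deletion (del p)
      avoid : ∀ {v} (q : P v) → v ≢ x → back E q ≢ back E p
      avoid q v≢x eq = v≢x (trans (sym (emb-back E q)) (trans (cong (emb E) eq) (emb-back E p)))

  CritOn⇒Critical : ∀ {H P k} → Embedding H P → CritOn P k → Critical k H
  CritOn⇒Critical {H} {P} {k} E (colourable , minimal , critical) =
    (ColOn⇒Colorable E colourable , λ c c<k → minimal c c<k ∘ Colorable⇒ColOn E P?) , sub
    where
    P? : Decidable P
    P? v with any? (λ i → emb E i ≟ v)
    ... | yes (i , refl) = yes (emb-in E i)
    ... | no ¬i          = no λ p → ¬i (back E p , emb-back E p)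
    sub : ∀ m (f : Fin m → Fin (size H)) → Injective _≡_ _≡_ f → m < size H → Colorable (k ∸ 1) (induced H f)
    sub m f f-inj m<n with missed f m<n
    ... | x , f≢x with critical (emb E x) (emb-in E x)
    ... | col , bound , proper =
      (λ i → fromℕ< (bound (emb E (f i)) (inside i))) ,
      λ i j ij eq → proper _ _ (inside i) (inside j) (trans (sym (emb-adj E (f i) (f j))) ij)
        (trans (sym (toℕ-fromℕ< _)) (trans (cong toℕ eq) (toℕ-fromℕ< _)))
      where
      inside : ∀ i → (P − emb E x) (emb E (f i))
      inside i = emb-in E (f i) , λ eq → f≢x i (emb-inj E eq)

  module Used {P : V → Set} (P? : Decidable P) {c} (C : ColOn P c) where
    col = proj₁ C
    bound = proj₁ (proj₂ C)
    proper = proj₂ (proj₂ C)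

    IsUsed : Fin c → Set
    IsUsed x = ∃ λ v → P v × col v ≡ toℕ x

    isUsed? : Decidable IsUsed
    isUsed? x = any? (λ v → P? v ×-dec (col v ℕ.≟ toℕ x))

    usedCount : ℕ
    usedCount = count isUsed?

    open Enumeration (enumerate isUsed?)

    -- Renumbering the colours that occur compresses the palette to them, so a set cannot show fewer
    -- colours than it needs.
    recolour : ColOn P usedCount
    recolour = extend , bound′ , proper′
      where
      used : ∀ v (p : P v) → IsUsed (fromℕ< (bound v p))
      used v p = v , p , sym (toℕ-fromℕ< _)
      open Extend P? (λ v p → toℕ (index (used v p)))
      bound′ : ∀ v → P v → extend v < usedCount
      bound′ v p with extend-on v p
      ... | q , eq = subst (_< usedCount) (sym eq) (toℕ<n _)
      proper′ : ∀ u v → P u → P v → adj G u v ≡ true → extend u ≢ extend v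
      proper′ u v p q uv eq with extend-on u p | extend-on v q
      ... | p′ , eu | q′ , ev = proper u v p q uv
        (trans (sym (toℕ-fromℕ< _)) (trans (cong toℕ
          (index-inj (used u p′) (used v q′) (toℕ-injective (trans (sym eu) (trans eq ev))))) (toℕ-fromℕ< _)))

    Needs⇒≤ : ∀ {w} → Needs P w → w ≤ usedCount
    Needs⇒≤ needs = ≮⇒≥ λ fewer → needs usedCount fewer recolour

    module Palette {w} (w≤ : w ≤ usedCount) where
      palette : ℕ → ℕ
      palette i with i <? w
      ... | yes i<w = toℕ (at (inject≤ (fromℕ< i<w) w≤))
      ... | no _    = 0

      -- The colour is really seen on `P`, so no vertex complete to `P` can carry it; repainting a
      -- module and counting a clique both rest on this.
      palette-used : ∀ {i} → i < w → palette i < c × (∃ λ v → P v × col v ≡ palette i)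
      palette-used {i} i<w with i <? w
      ... | yes lt = toℕ<n _ , at-sound _
      ... | no ¬lt = contradiction i<w ¬lt

      palette-inj : ∀ {i j} → i < w → j < w → palette i ≡ palette j → i ≡ j
      palette-inj {i} {j} i<w j<w eq with i <? w | j <? w
      ... | yes p | yes q = trans (sym (position p))
              (trans (cong toℕ (at-inj (toℕ-injective eq))) (position q))
        where
        position : ∀ {i} (p : i < w) → toℕ (inject≤ (fromℕ< p) w≤) ≡ i
        position p = trans (toℕ-inject≤ _ w≤) (toℕ-fromℕ< p)
      ... | yes _ | no ¬q = contradiction j<w ¬q
      ... | no ¬p | _     = contradiction i<w ¬p

  module Substitution {I : Set} (τ : V → I) (_≟ᴵ_ : ∀ (i j : I) → Dec (i ≡ j)) where

    Part : I → V → Set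
    Part i v = τ v ≡ i

    -- Each part is coloured on its own and its colours are renamed by `pal`. Disjointness is asked
    -- only across an edge, so nonadjacent bags may share colours.
    colour-parts : ∀ {P K} (a : I → ℕ) → (∀ i → ColOn (λ v → P v × Part i v) (a i)) → (pal : I → ℕ → ℕ) →
      (∀ i {j} → j < a i → pal i j < K) →
      (∀ i {j j′} → j < a i → j′ < a i → pal i j ≡ pal i j′ → j ≡ j′) →
      (∀ u v → P u → P v → adj G u v ≡ true → τ u ≢ τ v →
        ∀ {j j′} → j < a (τ u) → j′ < a (τ v) → pal (τ u) j ≢ pal (τ v) j′) →
      ColOn P K
    colour-parts {P} {K} a cols pal bound inj disj =
      (λ v → pal (τ v) (proj₁ (cols (τ v)) v)) , (λ v p → bound (τ v) (low v p)) , proper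
      where
      low : ∀ v → P v → proj₁ (cols (τ v)) v < a (τ v)
      low v p = proj₁ (proj₂ (cols (τ v))) v (p , refl)
      same : ∀ {i i′ u v} → P u → P v → adj G u v ≡ true → τ u ≡ i → τ v ≡ i′ → i ≡ i′ →
        proj₁ (cols i) u < a i → proj₁ (cols i′) v < a i′ →
        pal i (proj₁ (cols i) u) ≢ pal i′ (proj₁ (cols i′) v)
      same p q uv refl τv refl lu lv eq =
        proj₂ (proj₂ (cols _)) _ _ (p , refl) (q , τv) uv (inj _ lu lv eq)
      proper : ∀ u v → P u → P v → adj G u v ≡ true →
        pal (τ u) (proj₁ (cols (τ u)) u) ≢ pal (τ v) (proj₁ (cols (τ v)) v)
      proper u v p q uv with τ u ≟ᴵ τ v
      ... | yes eq = same p q uv refl refl eq (low u p) (low v q)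
      ... | no neq = disj u v p q uv neq (low u p) (low v q)

  IsModule : (V → Set) → Set
  IsModule M = ∀ {u v x} → M u → M v → ¬ M x → adj G u x ≡ adj G v x

  -- In a colouring of G − x the colours seen on M − x are unused on the neighbourhood of M, so if there
  -- are enough of them to colour M, they extend the colouring to x.
  module-critical : ∀ {M k m} → Decidable M → IsModule M → 1 ≤ k → CritOn All k →
    ColOn M m → Needs M m → CritOn M m
  module-critical {M} {suc k} {m} M? modular 1≤k (_ , minimal , critical) (colM , boundM , properM) needs =
    (colM , boundM , properM) , needs , delete
    where
    delete : ∀ x → M x → ColOn (M − x) (m ∸ 1)
    delete x mx with critical x tt
    ... | C@(col , bound , proper) = result
      where
      open Used (λ v → M? v ×-dec ¬? (v ≟ x)) (ColOn-⊆ {P = M − x} (λ v (_ , v≢x) → tt , v≢x) C)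
        using (usedCount; recolour; module Palette)
      away : ∀ {v} → ¬ M v → (All − x) v
      away ¬mv = tt , λ { refl → ¬mv mx }
      repaint : m ≤ usedCount → ColOn All k
      repaint m≤ = new , (λ v _ → new-bound v) , λ u v _ _ → new-proper u v
        where
        open Palette m≤
        new : V → ℕ
        new v with M? v
        ... | yes _ = palette (colM v)
        ... | no _  = col v
        new-bound : ∀ v → new v < k
        new-bound v with M? v
        ... | yes mv = proj₁ (palette-used (boundM v mv))
        ... | no ¬mv = bound v (away ¬mv)
        clash : ∀ u v → M u → ¬ M v → adj G u v ≡ true → palette (colM u) ≢ col v
        clash u v mu ¬mv uv eq with palette-used (boundM u mu)
        ... | _ , w , (mw , w≢x) , cw = proper w v (tt , w≢x) (away ¬mv) (trans (modular mw mu ¬mv) uv) (trans cw eq)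
        new-proper : ∀ u v → adj G u v ≡ true → new u ≢ new v
        new-proper u v uv eq with M? u | M? v
        ... | yes mu | yes mv = properM u v mu mv uv (palette-inj (boundM u mu) (boundM v mv) eq)
        ... | yes mu | no ¬mv = clash u v mu ¬mv uv eq
        ... | no ¬mu | yes mv = clash v u mv ¬mu (trans (adj-sym G v u) uv) (sym eq)
        ... | no ¬mu | no ¬mv = proper u v (away ¬mu) (away ¬mv) uv eq
      result : ColOn (M − x) (m ∸ 1)
      result with m ≤? usedCount
      ... | yes m≤ = contradiction (repaint m≤) (minimal k (n<1+n k))
      ... | no m≰  = ColOn-≤ (<⇒≤pred (≰⇒> m≰)) recolour

-- Weighted colourings of C5

sum5≡sum : ∀ a → sum5 a ≡ sum a
sum5≡sum a = solve 5 (λ p q r s t → p :+ q :+ r :+ s :+ t := p :+ (q :+ (r :+ (s :+ (t :+ con 0))))) refl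
  (a f0) (a f1) (a f2) (a f3) (a f4)
  where open +-*-Solver

sum5-mono-≤ : ∀ {a b} → (∀ i → a i ≤ b i) → sum5 a ≤ sum5 b
sum5-mono-≤ {a} {b} a≤b = subst₂ _≤_ (sym (sum5≡sum a)) (sym (sum5≡sum b)) (∑-mono-≤ a≤b)

sum5-mono-< : ∀ {a b} → (∀ i → a i ≤ b i) → ∀ i → a i < b i → sum5 a < sum5 b
sum5-mono-< {a} {b} a≤b i lt = subst₂ _<_ (sym (sum5≡sum a)) (sym (sum5≡sum b)) (∑-mono-< a≤b i lt)

sum5-∑ : ∀ {n} (f : Fin 5 → Fin n → ℕ) → sum5 (λ i → sum (f i)) ≡ sum (λ x → sum5 (λ i → f i x))
sum5-∑ f = trans (sum5≡sum (λ i → sum (f i))) (trans (∑-comm f) (sum-cong-≗ λ x → sym (sum5≡sum (λ i → f i x))))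

two-of-five : {U : Fin 5 → Set} (U? : Decidable U) → (∀ i → ¬ (U i × U (next i))) → sum5 (ind ∘ U?) ≤ 2
two-of-five U? excl
  with U? f0 | U? f1 | U? f2 | U? f3 | U? f4
... | yes p | yes q | _     | _     | _     = contradiction (p , q) (excl f0)
... | _     | yes p | yes q | _     | _     = contradiction (p , q) (excl f1)
... | _     | _     | yes p | yes q | _     = contradiction (p , q) (excl f2)
... | _     | _     | _     | yes p | yes q = contradiction (p , q) (excl f3)
... | yes q | _     | _     | _     | yes p = contradiction (p , q) (excl f4)
... | yes _ | no _  | yes _ | no _  | no _  = ≤-refl
... | yes _ | no _  | no _  | yes _ | no _  = ≤-refl
... | no _  | yes _ | no _  | yes _ | no _  = ≤-refl
... | no _  | yes _ | no _  | no _  | yes _ = ≤-refl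
... | no _  | no _  | yes _ | no _  | yes _ = ≤-refl
... | yes _ | no _  | no _  | no _  | no _  = s≤s z≤n
... | no _  | yes _ | no _  | no _  | no _  = s≤s z≤n
... | no _  | no _  | yes _ | no _  | no _  = s≤s z≤n
... | no _  | no _  | no _  | yes _ | no _  = s≤s z≤n
... | no _  | no _  | no _  | no _  | yes _ = s≤s z≤n
... | no _  | no _  | no _  | no _  | no _  = z≤n

c5-next : ∀ i j → c5Adj i j ≡ true → next i ≡ j ⊎ next j ≡ i
c5-next = from-yes (all? λ i → all? λ j → (c5Adj i j Bool.≟ true) →-dec ((next i ≟ j) ⊎-dec (next j ≟ i)))

next-adj : ∀ i → c5Adj i (next i) ≡ true
next-adj = from-yes (all? λ i → c5Adj i (next i) Bool.≟ true)

next-≢ : ∀ i → i ≢ next i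
next-≢ = from-yes (all? λ i → ¬? (i ≟ next i))

-- The palette of bag 0 starts at 0, that of bag 1 ends at K, bags 2 and 4 get intervals that overlap as much
-- as possible, and bag 3 gets the remaining colours cyclically, starting from the end e of their union [s, e).
module C5Palette (a : Fin 5 → ℕ) (K : ℕ) (edge : ∀ i → a i + a (next i) ≤ K) (total : sum5 a ≤ K + K) where

  a₀ a₁ a₂ a₃ a₄ t r s e : ℕ
  a₀ = a f0
  a₁ = a f1
  a₂ = a f2
  a₃ = a f3
  a₄ = a f4
  t = K ∸ a₁
  r = t ∸ a₂
  s = a₀ ⊓ r
  e = (s + a₂) ⊔ (a₀ + a₄)

  pal : Fin 5 → ℕ → ℕ
  pal f0 j = j
  pal f1 j = t + j
  pal f2 j = s + j
  pal f3 j with e + j <? K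
  ... | yes _ = e + j
  ... | no _  = (e + j) ∸ K
  pal f4 j = a₀ + j

  t+a₁ : t + a₁ ≡ K
  t+a₁ = m∸n+n≡m (≤-trans (m≤m+n a₁ a₂) (edge f1))

  a₂≤t : a₂ ≤ t
  a₂≤t = +-cancelʳ-≤ a₁ a₂ t (subst₂ _≤_ (+-comm a₁ a₂) (sym t+a₁) (edge f1))

  r+a₂ : r + a₂ ≡ t
  r+a₂ = m∸n+n≡m a₂≤t

  t≤K : t ≤ K
  t≤K = m∸n≤m K a₁

  s+a₂≤t : s + a₂ ≤ t
  s+a₂≤t = subst (s + a₂ ≤_) r+a₂ (+-monoˡ-≤ a₂ (m⊓n≤n a₀ r))

  a₀≤t : a₀ ≤ t
  a₀≤t = +-cancelʳ-≤ a₁ a₀ t (subst (a₀ + a₁ ≤_) (sym t+a₁) (edge f0))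

  a₀+a₄≤K : a₀ + a₄ ≤ K
  a₀+a₄≤K = subst (_≤ K) (+-comm a₄ a₀) (edge f4)

  -- Bag 3 runs on from e, may wrap around at K, and has to stop before s. If the union ends with
  -- bag 2, the edge between bags 2 and 3 suffices; if it starts at a₀ and ends with bag 4, the edge
  -- between bags 3 and 4 does. The total enters when bag 2 is pressed against bag 1 and the union
  -- ends with bag 4.
  room : e + a₃ ≤ K + s
  room with ⊔-sel (s + a₂) (a₀ + a₄)
  ... | inj₁ eq = begin
    e + a₃         ≡⟨ cong (_+ a₃) eq ⟩
    s + a₂ + a₃    ≡⟨ +-assoc s a₂ a₃ ⟩
    s + (a₂ + a₃)  ≤⟨ +-monoʳ-≤ s (edge f2) ⟩
    s + K          ≡⟨ +-comm s K ⟩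
    K + s          ∎
    where open ≤-Reasoning
  ... | inj₂ eq with ⊓-sel a₀ r
  ... | inj₁ s≡a₀ = begin
    e + a₃         ≡⟨ cong (_+ a₃) eq ⟩
    a₀ + a₄ + a₃   ≡⟨ solve 3 (λ x y z → x :+ y :+ z := z :+ y :+ x) refl a₀ a₄ a₃ ⟩
    a₃ + a₄ + a₀   ≤⟨ +-monoˡ-≤ a₀ (edge f3) ⟩
    K + a₀         ≡⟨ cong (K +_) (sym s≡a₀) ⟩
    K + s          ∎
    where open ≤-Reasoning
          open +-*-Solver
  ... | inj₂ s≡r = +-cancelʳ-≤ (a₁ + a₂) (e + a₃) (K + s) (begin
    e + a₃ + (a₁ + a₂)        ≡⟨ cong (λ z → z + a₃ + (a₁ + a₂)) eq ⟩
    a₀ + a₄ + a₃ + (a₁ + a₂)  ≡⟨ solve 5 (λ p q r s t → p :+ t :+ s :+ (q :+ r) := p :+ q :+ r :+ s :+ t) refl a₀ a₁ a₂ a₃ a₄ ⟩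
    sum5 a                    ≤⟨ total ⟩
    K + K                     ≡⟨ cong (K +_) (sym (trans (cong (_+ a₁) r+a₂) t+a₁)) ⟩
    K + (r + a₂ + a₁)         ≡⟨ solve 4 (λ k r x y → k :+ (r :+ y :+ x) := k :+ r :+ (x :+ y)) refl K r a₁ a₂ ⟩
    K + r + (a₁ + a₂)         ≡⟨ cong (λ z → K + z + (a₁ + a₂)) (sym s≡r) ⟩
    K + s + (a₁ + a₂)         ∎)
    where open ≤-Reasoning
          open +-*-Solver

  s≤e : s ≤ e
  s≤e = ≤-trans (m≤m+n s a₂) (m≤m⊔n (s + a₂) (a₀ + a₄))

  Wrapped : ℕ → ℕ → Set
  Wrapped j x = (x ≡ e + j × x < K) ⊎ (x + K ≡ e + j × x < s)

  wrapped : ∀ {j} → j < a₃ → Wrapped j (pal f3 j)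
  wrapped {j} j<a₃ with e + j <? K
  ... | yes lt = inj₁ (refl , lt)
  ... | no ≮K  = inj₂ (back , +-cancelʳ-< K _ _ (begin-strict
    e + j ∸ K + K  ≡⟨ back ⟩
    e + j          <⟨ +-monoʳ-< e j<a₃ ⟩
    e + a₃         ≤⟨ room ⟩
    K + s          ≡⟨ +-comm K s ⟩
    s + K          ∎))
    where
    open ≤-Reasoning
    back : e + j ∸ K + K ≡ e + j
    back = m∸n+n≡m (≮⇒≥ ≮K)

  wrapped-inj : ∀ {j j′ x} → Wrapped j x → Wrapped j′ x → j ≡ j′
  wrapped-inj (inj₁ (p , _)) (inj₁ (q , _)) = +-cancelˡ-≡ e _ _ (trans (sym p) q)
  wrapped-inj (inj₂ (p , _)) (inj₂ (q , _)) = +-cancelˡ-≡ e _ _ (trans (sym p) q)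
  wrapped-inj (inj₁ (refl , _)) (inj₂ (_ , x<s)) = contradiction (≤-trans s≤e (m≤m+n e _)) (<⇒≱ x<s)
  wrapped-inj (inj₂ (_ , x<s)) (inj₁ (refl , _)) = contradiction (≤-trans s≤e (m≤m+n e _)) (<⇒≱ x<s)

  wrapped-outside : ∀ {j x y} → Wrapped j x → s ≤ y → y < e → x ≢ y
  wrapped-outside (inj₁ (refl , _)) _   y<e refl = <⇒≱ y<e (m≤m+n e _)
  wrapped-outside (inj₂ (_ , x<s))  s≤y _   refl = <⇒≱ x<s s≤y

  pal-bound : ∀ i {j} → j < a i → pal i j < K
  pal-bound f0 j<a = <-≤-trans j<a (≤-trans a₀≤t t≤K)
  pal-bound f1 j<a = <-≤-trans (+-monoʳ-< t j<a) (≤-reflexive t+a₁)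
  pal-bound f2 j<a = <-≤-trans (+-monoʳ-< s j<a) (≤-trans s+a₂≤t t≤K)
  pal-bound f3 j<a with wrapped j<a
  ... | inj₁ (_ , lt) = lt
  ... | inj₂ (_ , lt) = <-≤-trans lt (≤-trans (m⊓n≤m a₀ r) (≤-trans a₀≤t t≤K))
  pal-bound f4 j<a = <-≤-trans (+-monoʳ-< a₀ j<a) a₀+a₄≤K

  pal-inj : ∀ i {j j′} → j < a i → j′ < a i → pal i j ≡ pal i j′ → j ≡ j′
  pal-inj f0 _ _ eq = eq
  pal-inj f1 _ _ eq = +-cancelˡ-≡ t _ _ eq
  pal-inj f2 _ _ eq = +-cancelˡ-≡ s _ _ eq
  pal-inj f3 j<a j′<a eq = wrapped-inj (subst (Wrapped _) eq (wrapped j<a)) (wrapped j′<a)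
  pal-inj f4 _ _ eq = +-cancelˡ-≡ a₀ _ _ eq

  pal-disjoint : ∀ i {j j′} → j < a i → j′ < a (next i) → pal i j ≢ pal (next i) j′
  pal-disjoint f0 j<a _ refl = <⇒≱ j<a (≤-trans a₀≤t (m≤m+n t _))
  pal-disjoint f1 _ j′<a eq = <⇒≱ (<-≤-trans (+-monoʳ-< s j′<a) s+a₂≤t) (≤-trans (m≤m+n t _) (≤-reflexive eq))
  pal-disjoint f2 j<a j′<a eq = wrapped-outside (wrapped j′<a) (m≤m+n s _)
    (<-≤-trans (+-monoʳ-< s j<a) (m≤m⊔n (s + a₂) (a₀ + a₄))) (sym eq)
  pal-disjoint f3 j<a j′<a = wrapped-outside (wrapped j<a) (≤-trans (m⊓n≤m a₀ r) (m≤m+n a₀ _))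
    (<-≤-trans (+-monoʳ-< a₀ j′<a) (m≤n⊔m (s + a₂) (a₀ + a₄)))
  pal-disjoint f4 _ j′<a refl = <⇒≱ j′<a (m≤m+n a₀ _)

-- Critical joins and buoys

module Lower {I : Set} (_≟ᴵ_ : ∀ (i j : I) → Dec (i ≡ j)) (a : I → ℕ) (x : I) where
  lower : I → ℕ
  lower i with i ≟ᴵ x
  ... | yes _ = a i ∸ 1
  ... | no _  = a i

  lower-≤ : ∀ i → lower i ≤ a i
  lower-≤ i with i ≟ᴵ x
  ... | yes _ = m∸n≤m (a i) 1
  ... | no _  = ≤-refl

  lower-< : 1 ≤ a x → lower x < a x
  lower-< 1≤a with x ≟ᴵ x
  ... | yes _ = pred-< 1≤a
    where
    pred-< : ∀ {m} → 1 ≤ m → m ∸ 1 < m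
    pred-< (s≤s _) = ≤-refl
  ... | no x≢x = contradiction refl x≢x

module CriticalParts (G : Graph) where
  open Colouring G

  Needs⇒1≤ : ∀ {P w x} → P x → ColOn P w → 1 ≤ w
  Needs⇒1≤ p (_ , bound , _) = ≤-trans (s≤s z≤n) (bound _ p)

  -- A colouring of `P − x` extends to `P` at the cost of one fresh colour for `x`.
  Needs-− : ∀ {P w} x → Needs P w → Needs (P − x) (w ∸ 1)
  Needs-− {P} {suc w} x needs c c<w (col , bound , proper) =
    needs (suc c) (s<s c<w) (new , new-bound , new-proper)
    where
    new : V → ℕ
    new v with v ≟ x
    ... | yes _ = c
    ... | no _  = col v
    new-bound : ∀ v → P v → new v < suc c
    new-bound v p with v ≟ x
    ... | yes _  = n<1+n c
    ... | no v≢x = <-trans (bound v (p , v≢x)) (n<1+n c)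
    new-proper : ∀ u v → P u → P v → adj G u v ≡ true → new u ≢ new v
    new-proper u v p q uv eq with u ≟ x | v ≟ x
    ... | yes refl | yes refl with () ← trans (sym uv) (adj-irr G u)
    new-proper u v p q uv eq | yes _ | no v≢x = <-irrefl (sym eq) (bound v (q , v≢x))
    new-proper u v p q uv eq | no u≢x | yes _ = <-irrefl eq (bound u (p , u≢x))
    new-proper u v p q uv eq | no u≢x | no v≢x = proper u v (p , u≢x) (q , v≢x) uv eq

  Complete : (V → Set) → (V → Set) → Set
  Complete A B = ∀ {u v} → A u → B v → adj G u v ≡ true

  used-disjoint : ∀ {A B Q : V → Set} {c} (A? : Decidable A) (B? : Decidable B) (C : ColOn Q c)
    (A⊆Q : ∀ v → A v → Q v) (B⊆Q : ∀ v → B v → Q v) → Complete A B → ∀ x →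
    ¬ (Used.IsUsed A? (ColOn-⊆ A⊆Q C) x × Used.IsUsed B? (ColOn-⊆ B⊆Q C) x)
  used-disjoint A? B? (col , _ , proper) A⊆Q B⊆Q complete x ((u , au , eu) , (v , bv , ev)) =
    proper u v (A⊆Q u au) (B⊆Q v bv) (complete au bv) (trans eu (sym ev))

  -- Complete sets show disjoint sets of colours. `Q` is kept separate from the two sets so that the
  -- bound also applies after a vertex is deleted.
  pair-bound : ∀ {A B Q : V → Set} {a b c} → Decidable A → Decidable B →
    (∀ v → A v → Q v) → (∀ v → B v → Q v) → Complete A B →
    Needs A a → Needs B b → ColOn Q c → a + b ≤ c
  pair-bound {a = a} {b} {c} A? B? A⊆Q B⊆Q complete needsA needsB C = begin
    a + b                        ≤⟨ +-mono-≤ (UA.Needs⇒≤ needsA) (UB.Needs⇒≤ needsB) ⟩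
    UA.usedCount + UB.usedCount  ≡⟨ sym (∑-distrib-+ (ind ∘ UA.isUsed?) (ind ∘ UB.isUsed?)) ⟩
    sum (λ x → ind (UA.isUsed? x) + ind (UB.isUsed? x))
      ≤⟨ ∑-bound 1 (λ x → exclusive (UA.isUsed? x) (UB.isUsed? x) (used-disjoint A? B? C A⊆Q B⊆Q complete x)) ⟩
    c * 1                        ≡⟨ solve 1 (λ c → c :* con 1 := c) refl c ⟩
    c                            ∎
    where
    open ≤-Reasoning
    open +-*-Solver
    module UA = Used A? (ColOn-⊆ A⊆Q C)
    module UB = Used B? (ColOn-⊆ B⊆Q C)
    exclusive : ∀ {X Y : Set} (X? : Dec X) (Y? : Dec Y) → ¬ (X × Y) → ind X? + ind Y? ≤ 1
    exclusive (yes x) (yes y) ¬xy = contradiction (x , y) ¬xy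
    exclusive (yes _) (no _)  _   = ≤-refl
    exclusive (no _)  (yes _) _   = ≤-refl
    exclusive (no _)  (no _)  _   = z≤n

  -- Double counting of the pairs of a bag and a colour that it shows.
  five-bound : ∀ {A : Fin 5 → V → Set} {Q : V → Set} {a : Fin 5 → ℕ} {c} → (∀ i → Decidable (A i)) →
    (∀ i v → A i v → Q v) → (∀ i → Complete (A i) (A (next i))) →
    (∀ i → Needs (A i) (a i)) → ColOn Q c → sum5 a ≤ c * 2
  five-bound {A} {a = a} {c} A? A⊆Q complete needs C = begin
    sum5 a                      ≤⟨ sum5-mono-≤ {a} (λ i → U.Needs⇒≤ i (needs i)) ⟩
    sum5 (λ i → U.usedCount i)  ≡⟨ sum5-∑ (λ i x → ind (U.isUsed? i x)) ⟩
    sum (λ x → sum5 (λ i → ind (U.isUsed? i x)))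
      ≤⟨ ∑-bound 2 (λ x → two-of-five (λ i → U.isUsed? i x)
           (λ i → used-disjoint (A? i) (A? (next i)) C (A⊆Q i) (A⊆Q (next i)) (complete i) x)) ⟩
    c * 2                       ∎
    where
    open ≤-Reasoning
    module U (i : Fin 5) = Used (A? i) (ColOn-⊆ (A⊆Q i) C)

  Needs-≤ : ∀ {P w c} → Needs P w → ColOn P c → w ≤ c
  Needs-≤ {c = c} needs C = ≮⇒≥ λ c<w → needs c c<w C

  module PartColours {I : Set} (τ : V → I) (_≟ᴵ_ : ∀ (i j : I) → Dec (i ≡ j)) where
    open Substitution τ _≟ᴵ_ public

    part? : ∀ i → Decidable (Part i)
    part? i v = τ v ≟ᴵ i

    delete-cols : ∀ {k : I → ℕ} → (∀ i → CritOn (Part i) (k i)) → ∀ x i →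
      ColOn (λ v → (All − x) v × Part i v) (Lower.lower _≟ᴵ_ k (τ x) i)
    delete-cols crit x i with i ≟ᴵ τ x
    ... | yes refl = ColOn-⊆ (λ v ((_ , v≢x) , eq) → eq , v≢x) (proj₂ (proj₂ (crit i)) x refl)
    ... | no _     = ColOn-⊆ (λ v (_ , eq) → eq) (proj₁ (crit i))

  module JoinPartition (τ : V → Bool) (complete : ∀ u v → τ u ≢ τ v → adj G u v ≡ true) where
    open PartColours τ Bool._≟_ public

    true-false : Complete (Part true) (Part false)
    true-false eu ev = complete _ _ λ eq → contradiction (trans (sym eu) (trans eq ev)) λ ()

    join-colour : ∀ {Q} (a : Bool → ℕ) → (∀ b → ColOn (λ v → Q v × Part b v) (a b)) → ColOn Q (a true + a false)
    join-colour a cols = colour-parts a cols pal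
      (λ { true j<a → <-≤-trans j<a (m≤m+n _ _) ; false j<a → +-monoʳ-< (a true) j<a })
      (λ { true _ _ eq → eq ; false _ _ eq → +-cancelˡ-≡ (a true) _ _ eq })
      (λ u v _ _ _ neq → disjoint (τ u) (τ v) neq)
      where
      pal : Bool → ℕ → ℕ
      pal true  j = j
      pal false j = a true + j
      disjoint : ∀ b b′ → b ≢ b′ → ∀ {j j′} → j < a b → j′ < a b′ → pal b j ≢ pal b′ j′
      disjoint true  true  neq = contradiction refl neq
      disjoint false false neq = contradiction refl neq
      disjoint true  false _ j<a _    refl = <⇒≱ j<a (m≤m+n _ _)
      disjoint false true  _ _   j<a′ refl = <⇒≱ j<a′ (m≤m+n _ _)

    join-bound : ∀ {a b c} → Needs (Part true) a → Needs (Part false) b → ColOn All c → a + b ≤ c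
    join-bound = pair-bound (part? true) (part? false) (λ _ _ → tt) (λ _ _ → tt) true-false

    join-critical : ∀ k → (∀ b → 1 ≤ k b) → (∀ b → CritOn (Part b) (k b)) → CritOn All (k true + k false)
    join-critical k 1≤k crit =
      join-colour k (λ b → ColOn-⊆ (λ _ → proj₂) (proj₁ (crit b))) ,
      (λ c c<k C → <⇒≱ c<k (join-bound (proj₁ (proj₂ (crit true))) (proj₁ (proj₂ (crit false))) C)) ,
      λ x _ → ColOn-≤ (fewer (τ x)) (join-colour (Lower.lower Bool._≟_ k (τ x)) (delete-cols crit x))
      where
      fewer : ∀ b → Lower.lower Bool._≟_ k b true + Lower.lower Bool._≟_ k b false ≤ k true + k false ∸ 1
      fewer true  = <⇒≤pred (+-mono-<-≤ (lower-< (1≤k true)) (lower-≤ false))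
        where open Lower Bool._≟_ k true
      fewer false = <⇒≤pred (+-mono-≤-< (lower-≤ true) (lower-< (1≤k false)))
        where open Lower Bool._≟_ k false

    join-parts : ∀ {k} → 1 ≤ k → CritOn All k → (∀ b → ∃ (Part b)) →
      Σ (Bool → ℕ) λ ks → (∀ b → 1 ≤ ks b) × ks true + ks false ≡ k × (∀ b → CritOn (Part b) (ks b))
    join-parts {k} 1≤k crit nonempty = ks ,
      (λ b → Needs⇒1≤ (proj₂ (nonempty b)) (colours b)) ,
      ≤-antisym (join-bound (needs true) (needs false) (proj₁ crit))
        (Needs-≤ (proj₁ (proj₂ crit)) (join-colour ks λ b → ColOn-⊆ (λ _ → proj₂) (colours b))) ,
      λ b → module-critical (part? b) (modular b) 1≤k crit (colours b) (needs b)
      where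
      ks : Bool → ℕ
      ks b = proj₁ (chromatic (part? b))
      colours : ∀ b → ColOn (Part b) (ks b)
      colours b = proj₁ (proj₂ (chromatic (part? b)))
      needs : ∀ b → Needs (Part b) (ks b)
      needs b = proj₂ (proj₂ (chromatic (part? b)))
      modular : ∀ b → IsModule (Part b)
      modular b refl eq ¬x = trans (complete _ _ (≢-sym ¬x)) (sym (complete _ _ λ eq′ → ¬x (trans (sym eq′) eq)))

  module BuoyPartition (τ : V → Fin 5) (cross : ∀ u v → τ u ≢ τ v → adj G u v ≡ c5Adj (τ u) (τ v)) where
    open PartColours τ _≟_ public

    consecutive : ∀ i → Complete (Part i) (Part (next i))
    consecutive i refl eq = trans (cross _ _ λ eq′ → next-≢ i (trans eq′ eq)) (trans (cong (c5Adj i) eq) (next-adj i))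

    buoy-colour : ∀ {Q} a {K} → (∀ i → a i + a (next i) ≤ K) → sum5 a ≤ K + K →
      (∀ i → ColOn (λ v → Q v × Part i v) (a i)) → ColOn Q K
    buoy-colour a {K} edge total cols = colour-parts a cols pal pal-bound pal-inj
      λ u v _ _ uv neq → disjoint (c5-next _ _ (trans (sym (cross u v neq)) uv))
      where
      open C5Palette a K edge total
      disjoint : ∀ {i i′} → next i ≡ i′ ⊎ next i′ ≡ i → ∀ {j j′} → j < a i → j′ < a i′ → pal i j ≢ pal i′ j′
      disjoint (inj₁ refl) j<a j′<a = pal-disjoint _ j<a j′<a
      disjoint (inj₂ refl) j<a j′<a eq = pal-disjoint _ j′<a j<a (sym eq)

    buoy-bound : ∀ {a c} → (∀ i → Needs (Part i) (a i)) → ColOn All c → sum5 a ≤ c * 2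
    buoy-bound = five-bound part? (λ _ _ _ → tt) consecutive

    double : ∀ k → k * 2 ≡ k + k
    double k = solve 1 (λ k → k :* con 2 := k :+ k) refl k
      where open +-*-Solver

    buoy-critical : ∀ {k} ks → 1 ≤ k → (∀ i → 1 ≤ ks i) → (∀ i → CritOn (Part i) (ks i)) →
      (∀ i → ks i + ks (next i) ≤ k ∸ 1) → sum5 ks ≡ 2 * k ∸ 1 → CritOn All k
    buoy-critical {suc k} ks _ 1≤ks crit edge total =
      buoy-colour ks (λ i → ≤-trans (edge i) (n≤1+n k))
        (≤-trans (≤-reflexive total′) (≤-trans (n≤1+n _) (≤-reflexive (cong suc (sym (+-suc k k))))))
        (λ i → ColOn-⊆ (λ _ → proj₂) (proj₁ (crit i))) ,
      (λ c c<k C → odd (≤-pred c<k) (subst₂ _≤_ total′ (double c) (buoy-bound (λ i → proj₁ (proj₂ (crit i))) C))) ,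
      λ x _ → let open Lower _≟_ ks (τ x) in
        buoy-colour lower (λ i → ≤-trans (+-mono-≤ (lower-≤ i) (lower-≤ (next i))) (edge i))
          (≤-pred (≤-trans (sum5-mono-< {lower} lower-≤ (τ x) (lower-< (1≤ks (τ x)))) (≤-reflexive total′)))
          (delete-cols crit x)
      where
      total′ : sum5 ks ≡ suc (k + k)
      total′ = trans total (solve 1 (λ k → k :+ (con 1 :+ (k :+ con 0)) := con 1 :+ (k :+ k)) refl k)
        where open +-*-Solver
      odd : ∀ {c} → c ≤ k → ¬ (suc (k + k) ≤ c + c)
      odd c≤k lt = <⇒≱ lt (+-mono-≤ c≤k c≤k)

    buoy-parts : ∀ {k} → 2 ≤ k → CritOn All k → (∀ i → ∃ (Part i)) →
      Σ (Fin 5 → ℕ) λ ks → (∀ i → 1 ≤ ks i) × (∀ i → CritOn (Part i) (ks i)) ×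
        (∀ i → ks i + ks (next i) ≤ k ∸ 1) × sum5 ks ≡ 2 * k ∸ 1
    buoy-parts {suc k} _ crit@(_ , minimal , critical) nonempty = ks , 1≤ks ,
      (λ i → module-critical (part? i) (modular i) (s≤s z≤n) crit (colours i) (needs i)) , edge ,
      trans (≤-antisym upper lower) (sym (solve 1 (λ k → k :+ (con 1 :+ (k :+ con 0)) := con 1 :+ (k :+ k)) refl k))
      where
      open +-*-Solver
      ks : Fin 5 → ℕ
      ks i = proj₁ (chromatic (part? i))
      colours : ∀ i → ColOn (Part i) (ks i)
      colours i = proj₁ (proj₂ (chromatic (part? i)))
      needs : ∀ i → Needs (Part i) (ks i)
      needs i = proj₂ (proj₂ (chromatic (part? i)))
      1≤ks : ∀ i → 1 ≤ ks i
      1≤ks i = Needs⇒1≤ (proj₂ (nonempty i)) (colours i)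
      modular : ∀ i → IsModule (Part i)
      modular i {u} {v} {x} refl eq ¬x =
        trans (cross u x (≢-sym ¬x)) (trans (cong (λ j → c5Adj j (τ x)) (sym eq))
          (sym (cross v x λ eq′ → ¬x (trans (sym eq′) eq))))
      avoid : ∀ i j → ∃ λ l → l ≢ i × l ≢ j
      avoid = from-yes (all? λ i → all? λ j → any? {n = 5} λ l → ¬? (l ≟ i) ×-dec ¬? (l ≟ j))
      -- The deleted vertex is taken outside both bags, which therefore stay intact in a graph with
      -- one colour fewer.
      edge : ∀ i → ks i + ks (next i) ≤ k
      edge i with avoid i (next i)
      ... | l , l≢i , l≢j with nonempty l
      ... | x , refl = pair-bound {Q = All − x} (part? i) (part? (next i))
        (λ v eq → tt , λ { refl → l≢i eq }) (λ v eq → tt , λ { refl → l≢j eq })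
        (consecutive i) (needs i) (needs (next i)) (critical x tt)
      -- `edge` already holds with one colour fewer than the chromatic number, so a smaller total
      -- would permit a colouring with that many.
      lower : suc (k + k) ≤ sum5 ks
      lower = ≮⇒≥ λ less → minimal k (n<1+n k)
        (buoy-colour ks edge (≤-pred less) λ i → ColOn-⊆ (λ _ → proj₂) (colours i))
      -- Deleting a vertex of bag 0 lowers the need of that bag by at most one and leaves the other
      -- bags alone; what remains is at most twice the colours left.
      upper : sum5 ks ≤ suc (k + k)
      upper with nonempty f0
      ... | x , τx = ≤-trans (bump (1≤ks f0)) (s≤s (≤-trans
        (five-bound {A = λ i v → Part i v × v ≢ x} {Q = All − x} {a = fewer} (λ i v → part? i v ×-dec ¬? (v ≟ x))
          (λ i v (_ , v≢x) → tt , v≢x) (λ i (p , _) (q , _) → consecutive i p q) needs′ (critical x tt)) (≤-reflexive (double k))))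
        where
        fewer : Fin 5 → ℕ
        fewer f0     = ks f0 ∸ 1
        fewer (fs i) = ks (fs i)
        bump : 1 ≤ ks f0 → sum5 ks ≤ suc (sum5 fewer)
        bump 1≤ with ks f0
        bump (s≤s _) | suc _ = ≤-refl
        needs′ : ∀ i → Needs (λ v → Part i v × v ≢ x) (fewer i)
        needs′ f0     = Needs-− x (needs f0)
        needs′ (fs i) c c<w C =
          needs (fs i) c c<w (ColOn-⊆ (λ { v eq → eq , λ { refl → 0≢1+n (trans (sym τx) eq) } }) C)

-- Vertices around an induced C5

pairs-of-five : {E : Fin 5 → Fin 5 → Set} → (∀ {i j} → E i j → E j i) → (∀ i → E i i) →
  E f0 f1 → E f1 f2 → E f2 f3 → E f3 f4 → E f0 f2 → E f1 f3 → E f2 f4 → E f0 f3 → E f1 f4 → E f0 f4 → ∀ i j → E i j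
pairs-of-five {E} s d e01 e12 e23 e34 e02 e13 e24 e03 e14 e04 = table
  where
  table : ∀ i j → E i j
  table f0 f0 = d f0
  table f0 f1 = e01
  table f0 f2 = e02
  table f0 f3 = e03
  table f0 f4 = e04
  table f1 f0 = s e01
  table f1 f1 = d f1
  table f1 f2 = e12
  table f1 f3 = e13
  table f1 f4 = e14
  table f2 f0 = s e02
  table f2 f1 = s e12
  table f2 f2 = d f2
  table f2 f3 = e23
  table f2 f4 = e24
  table f3 f0 = s e03
  table f3 f1 = s e13
  table f3 f2 = s e23
  table f3 f3 = d f3
  table f3 f4 = e34
  table f4 f0 = s e04
  table f4 f1 = s e14
  table f4 f2 = s e24
  table f4 f3 = s e34
  table f4 f4 = d f4

-- Adjacency tells the vertices of such a graph apart, so a map out of it that preserves edges and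
-- non-edges is automatically injective. Copies of P5 and of its complement can then be given
-- without proofs that their vertices are distinct.
TwinFree : Graph → Set
TwinFree H = ∀ i j → i ≢ j → ∃ λ l → adj H i l ≢ adj H j l

twinFree? : ∀ H → Dec (TwinFree H)
twinFree? H = all? λ i → all? λ j → ¬? (i ≟ j) →-dec any? λ l → ¬? (adj H i l Bool.≟ adj H j l)

P5-twinFree : TwinFree P5
P5-twinFree = from-yes (twinFree? P5)

coP5-twinFree : TwinFree coP5
coP5-twinFree = from-yes (twinFree? coP5)

twinFree-contains : ∀ {G H} → TwinFree H → (f : Fin (size H) → Fin (size G)) →
  (∀ i j → adj H i j ≡ adj G (f i) (f j)) → ContainsInduced G H
twinFree-contains {G} {H} twinFree f f-adj = f , inj , f-adj
  where
  inj : Injective _≡_ _≡_ f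
  inj {i} {j} eq with i ≟ j
  ... | yes i≡j = i≡j
  ... | no i≢j with l , ne ← twinFree i j i≢j =
    contradiction (trans (f-adj i l) (trans (cong (λ x → adj G x (f l)) eq) (sym (f-adj j l)))) ne

module FreeGraph (G : Graph) (free : P5coP5Free G) where
  open Colouring G using (V)

  infix 4 _~_ _≁_
  _~_ _≁_ : V → V → Set
  u ~ v = adj G u v ≡ true
  u ≁ v = adj G u v ≡ false

  ~-sym : ∀ {u v} → u ~ v → v ~ u
  ~-sym {u} {v} = trans (adj-sym G v u)

  ≁-sym : ∀ {u v} → u ≁ v → v ≁ u
  ≁-sym {u} {v} = trans (adj-sym G v u)

  ~⇒¬≁ : ∀ {u v} → u ~ v → ¬ (u ≁ v)
  ~⇒¬≁ p q with () ← trans (sym p) q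

  adjacent? : ∀ u v → u ~ v ⊎ u ≁ v
  adjacent? u v with adj G u v
  ... | true  = inj₁ refl
  ... | false = inj₂ refl

  private
    copy : (H : Fin 5 → Fin 5 → Bool) → (∀ i j → H i j ≡ H j i) → (∀ i → H i i ≡ false) → (f : Fin 5 → V) →
      let E i j = H i j ≡ adj G (f i) (f j) in
      E f0 f1 → E f1 f2 → E f2 f3 → E f3 f4 → E f0 f2 → E f1 f3 → E f2 f4 → E f0 f3 → E f1 f4 → E f0 f4 → ∀ i j → E i j
    copy H H-sym H-irr f = pairs-of-five {λ i j → H i j ≡ adj G (f i) (f j)}
      (λ {i} {j} e → trans (H-sym j i) (trans e (adj-sym G _ _))) (λ i → trans (H-irr i) (sym (adj-irr G (f i))))

  no-P5 : ∀ {a b c d e} → a ~ b → b ~ c → c ~ d → d ~ e → a ≁ c → b ≁ d → c ≁ e → a ≁ d → b ≁ e → a ≁ e → ⊥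
  no-P5 {a} {b} {c} {d} {e} ab bc cd de ac bd ce ad be ae =
    proj₁ free (twinFree-contains {G} {P5} P5-twinFree f
      (copy (adj P5) (adj-sym P5) (adj-irr P5) f
        (sym ab) (sym bc) (sym cd) (sym de) (sym ac) (sym bd) (sym ce) (sym ad) (sym be) (sym ae)))
    where
    f : Fin 5 → V
    f = a ◂ b ◂ c ◂ d ◂ e ◂ ⟨⟩

  -- The vertices are listed along the P5 of the complement: consecutive ones are nonadjacent.
  no-house : ∀ {a b c d e} → a ≁ b → b ≁ c → c ≁ d → d ≁ e → a ~ c → b ~ d → c ~ e → a ~ d → b ~ e → a ~ e → ⊥
  no-house {a} {b} {c} {d} {e} ab bc cd de ac bd ce ad be ae =
    proj₂ free (twinFree-contains {G} {coP5} coP5-twinFree f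
      (copy (adj coP5) (adj-sym coP5) (adj-irr coP5) f
        (sym ab) (sym bc) (sym cd) (sym de) (sym ac) (sym bd) (sym ce) (sym ad) (sym be) (sym ae)))
    where
    f : Fin 5 → V
    f = a ◂ b ◂ c ◂ d ◂ e ◂ ⟨⟩

  C5 : (a b c d e : V) → Set
  C5 a b c d e = a ~ b × b ~ c × c ~ d × d ~ e × e ~ a × a ≁ c × b ≁ d × c ≁ e × d ≁ a × e ≁ b

  C5? : ∀ a b c d e → Dec (C5 a b c d e)
  C5? a b c d e = is a b true ×-dec is b c true ×-dec is c d true ×-dec is d e true ×-dec is e a true ×-dec
    is a c false ×-dec is b d false ×-dec is c e false ×-dec is d a false ×-dec is e b false
    where
    is : ∀ u v b → Dec (adj G u v ≡ b)
    is u v b = adj G u v Bool.≟ b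

  rotate : ∀ {a b c d e} → C5 a b c d e → C5 b c d e a
  rotate (ab , bc , cd , de , ea , ac , bd , ce , da , eb) = bc , cd , de , ea , ab , bd , ce , da , eb , ac

  rotate² : ∀ {a b c d e} → C5 a b c d e → C5 c d e a b
  rotate² z = rotate (rotate z)

  rotate³ : ∀ {a b c d e} → C5 a b c d e → C5 d e a b c
  rotate³ z = rotate (rotate² z)

  rotate⁴ : ∀ {a b c d e} → C5 a b c d e → C5 e a b c d
  rotate⁴ z = rotate (rotate³ z)

  -- `v` can take the place of `a` on the cycle; its adjacency to `a` itself is left open.
  InBag : (a b c d e v : V) → Set
  InBag a b c d e v = v ~ b × v ~ e × v ≁ c × v ≁ d

  inBag? : ∀ a b c d e → Decidable (InBag a b c d e)
  inBag? a b c d e v = (adj G v b Bool.≟ true) ×-dec (adj G v e Bool.≟ true) ×-dec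
    (adj G v c Bool.≟ false) ×-dec (adj G v d Bool.≟ false)

  self : ∀ {a b c d e} → C5 a b c d e → InBag a b c d e a
  self (ab , _ , _ , _ , ea , ac , _ , _ , da , _) = ab , ~-sym ea , ac , ≁-sym da

  replace : ∀ {a b c d e v} → C5 a b c d e → InBag a b c d e v → C5 v b c d e
  replace (_ , bc , cd , de , _ , _ , bd , ce , _ , eb) (vb , ve , vc , vd) =
    vb , bc , cd , de , ~-sym ve , vc , bd , ce , ≁-sym vd , eb

  second-neighbour : ∀ {a b c d e v} → C5 a b c d e → v ~ b → v ≁ c → v ≁ d → v ~ e
  second-neighbour {e = e} {v} (_ , bc , cd , de , _ , _ , bd , ce , _ , eb) vb vc vd with adjacent? v e
  ... | inj₁ ve = ve
  ... | inj₂ ve = ⊥-elim (no-P5 vb bc cd de vc bd ce vd (≁-sym eb) ve)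

  -- This is `second-neighbour` in the complement, contraposed: the non-edges of the cycle form the
  -- C5 `a c e b d`, whose path `d b e c` would be prolonged by `v`.
  second-nonneighbour : ∀ {a b c d e v} → C5 a b c d e → v ≁ c → v ~ d → v ~ e → v ≁ b
  second-nonneighbour {b = b} {v = v} (_ , bc , cd , de , _ , _ , bd , ce , _ , eb) vc vd ve with adjacent? v b
  ... | inj₁ vb = ⊥-elim (no-house
    (≁-sym bd) (≁-sym eb) (≁-sym ce) (≁-sym vc) de bc (~-sym ve) (~-sym cd) (~-sym vb) (~-sym vd))
  ... | inj₂ vb = vb

  -- A vertex neither complete nor anticomplete to the cycle has a neighbour followed by a
  -- non-neighbour in the cyclic order. This one change forces it to resemble one of the two cycle
  -- neighbours of `b`.
  descent : ∀ {a b c d e v} → C5 a b c d e → v ~ b → v ≁ c → InBag a b c d e v ⊎ InBag c d e a b v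
  descent {a} {d = d} {e} {v} z vb vc with adjacent? v d
  ... | inj₂ vd = inj₁ (vb , second-neighbour z vb vc vd , vc , vd)
  ... | inj₁ vd with adjacent? v e
  ... | inj₁ ve = ⊥-elim (~⇒¬≁ vb (second-nonneighbour z vc vd ve))
  ... | inj₂ ve with adjacent? v a
  ... | inj₁ va = ⊥-elim (~⇒¬≁ vd (second-nonneighbour (rotate² z) ve va vb))
  ... | inj₂ va = inj₂ (vd , vb , ve , va)

  AllAdj NoneAdj : (a b c d e v : V) → Set
  AllAdj  a b c d e v = v ~ a × v ~ b × v ~ c × v ~ d × v ~ e
  NoneAdj a b c d e v = v ≁ a × v ≁ b × v ≁ c × v ≁ d × v ≁ e

  -- Putting `u` in the place of `a` gives a new C5, so a question about two vertices becomes one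
  -- about `v` and a cycle. The next three lemmas make the same exchange.
  next-bag : ∀ {a b c d e u v} → C5 a b c d e → InBag a b c d e u → InBag b c d e a v → u ~ v
  next-bag z ub (vc , _ , vd , ve) = ~-sym (second-neighbour (rotate (replace z ub)) vc vd ve)

  opposite-bag : ∀ {a b c d e u v} → C5 a b c d e → InBag a b c d e u → InBag c d e a b v → u ≁ v
  opposite-bag {u = u} {v} z ub (vd , vb , ve , va) with adjacent? u v
  ... | inj₂ uv = uv
  ... | inj₁ uv = ⊥-elim (~⇒¬≁ vd (second-nonneighbour (rotate² (replace z ub)) ve (~-sym uv) vb))

  none-bag : ∀ {a b c d e u v} → C5 a b c d e → InBag a b c d e u → NoneAdj a b c d e v → u ≁ v
  none-bag {u = u} {v} z ub (_ , vb , vc , vd , _) with adjacent? u v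
  ... | inj₂ uv = uv
  ... | inj₁ uv = ⊥-elim (~⇒¬≁ (second-neighbour (rotate⁴ (replace z ub)) (~-sym uv) vb vc) vd)

  all-bag : ∀ {a b c d e u v} → C5 a b c d e → InBag a b c d e u → AllAdj a b c d e v → u ~ v
  all-bag {u = u} {v} z ub (_ , vb , vc , _ , ve) with adjacent? u v
  ... | inj₁ uv = uv
  ... | inj₂ uv = ⊥-elim (~⇒¬≁ ve (second-nonneighbour (rotate³ (replace z ub)) (≁-sym uv) vb vc))

  module Bags {a b c d e} (z : C5 a b c d e) where

    Bag : Fin 5 → V → Set
    Bag f0                     = InBag a b c d e
    Bag f1                = InBag b c d e a
    Bag f2           = InBag c d e a b
    Bag f3      = InBag d e a b c
    Bag f4 = InBag e a b c d

    Bagged : V → Set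
    Bagged v = ∃ λ i → Bag i v

    bag-nonempty : ∀ i → ∃ (Bag i)
    bag-nonempty f0                     = a , self z
    bag-nonempty f1                = b , self (rotate z)
    bag-nonempty f2           = c , self (rotate² z)
    bag-nonempty f3      = d , self (rotate³ z)
    bag-nonempty f4 = e , self (rotate⁴ z)

    bag-cross : ∀ i j {u v} → Bag i u → Bag j v → i ≢ j → adj G u v ≡ c5Adj i j
    bag-cross i j {u} {v} ui vj i≢j = pairs-of-five
      {λ i j → ∀ {u v} → Bag i u → Bag j v → i ≢ j → adj G u v ≡ c5Adj i j}
      (λ {i} {j} h vj ui i≢j → trans (adj-sym G _ _) (trans (h ui vj (≢-sym i≢j)) (c5Adj-sym i j)))
      (λ i _ _ i≢i → contradiction refl i≢i)
      (λ p q _ → next-bag z p q) (λ p q _ → next-bag (rotate z) p q)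
      (λ p q _ → next-bag (rotate² z) p q) (λ p q _ → next-bag (rotate³ z) p q)
      (λ p q _ → opposite-bag z p q) (λ p q _ → opposite-bag (rotate z) p q) (λ p q _ → opposite-bag (rotate² z) p q)
      (λ p q _ → ≁-sym (opposite-bag (rotate³ z) q p)) (λ p q _ → ≁-sym (opposite-bag (rotate⁴ z) q p))
      (λ p q _ → ~-sym (next-bag (rotate⁴ z) q p))
      i j ui vj i≢j
      where
      c5Adj-sym : ∀ i j → c5Adj i j ≡ c5Adj j i
      c5Adj-sym = from-yes (all? λ i → all? λ j → c5Adj i j Bool.≟ c5Adj j i)

    bag? : ∀ i → Decidable (Bag i)
    bag? f0                     = inBag? a b c d e
    bag? f1                = inBag? b c d e a
    bag? f2           = inBag? c d e a b
    bag? f3      = inBag? d e a b c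
    bag? f4 = inBag? e a b c d

    classify : ∀ v → Bagged v ⊎ NoneAdj a b c d e v ⊎ AllAdj a b c d e v
    classify v with adjacent? v a | adjacent? v b | adjacent? v c | adjacent? v d | adjacent? v e
    ... | inj₁ va | inj₁ vb | inj₁ vc | inj₁ vd | inj₁ ve = inj₂ (inj₂ (va , vb , vc , vd , ve))
    ... | inj₂ va | inj₂ vb | inj₂ vc | inj₂ vd | inj₂ ve = inj₂ (inj₁ (va , vb , vc , vd , ve))
    ... | inj₁ va | inj₂ vb | _ | _ | _ = inj₁ ([ (f4 ,_) , (f1 ,_) ]′ (descent (rotate⁴ z) va vb))
    ... | inj₁ _ | inj₁ vb | inj₂ vc | _ | _ = inj₁ ([ (f0 ,_) , (f2 ,_) ]′ (descent z vb vc))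
    ... | inj₁ _ | inj₁ _ | inj₁ vc | inj₂ vd | _ = inj₁ ([ (f1 ,_) , (f3 ,_) ]′ (descent (rotate z) vc vd))
    ... | inj₁ _ | inj₁ _ | inj₁ _ | inj₁ vd | inj₂ ve = inj₁ ([ (f2 ,_) , (f4 ,_) ]′ (descent (rotate² z) vd ve))
    ... | inj₂ va | _ | _ | _ | inj₁ ve = inj₁ ([ (f3 ,_) , (f0 ,_) ]′ (descent (rotate³ z) ve va))
    ... | inj₂ _ | _ | _ | inj₁ vd | inj₂ ve = inj₁ ([ (f2 ,_) , (f4 ,_) ]′ (descent (rotate² z) vd ve))
    ... | inj₂ _ | _ | inj₁ vc | inj₂ vd | inj₂ _ = inj₁ ([ (f1 ,_) , (f3 ,_) ]′ (descent (rotate z) vc vd))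
    ... | inj₂ _ | inj₁ vb | inj₂ vc | inj₂ _ | inj₂ _ = inj₁ ([ (f0 ,_) , (f2 ,_) ]′ (descent z vb vc))

-- Contraction of buoys

c5-separates : ∀ i j → i ≢ j → ∃ λ l → l ≢ i × l ≢ j × c5Adj i l ≢ c5Adj j l
c5-separates = from-yes (all? λ i → all? λ j → ¬? (i ≟ j) →-dec any? {n = 5} λ l →
  ¬? (l ≟ i) ×-dec ¬? (l ≟ j) ×-dec ¬? (c5Adj i l Bool.≟ c5Adj j l))

module Quotients (G : Graph) (free : P5coP5Free G) where
  open Colouring G using (V)
  open FreeGraph G free

  -- A partition of the vertices into modules, given by a choice of representatives.
  record Quotient : Set where
    field
      rep   : V → V
      idem  : ∀ v → rep (rep v) ≡ rep v
      r-adj : ∀ {u v} → rep u ≢ rep v → adj G u v ≡ adj G (rep u) (rep v)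

    IsRep : V → Set
    IsRep v = rep v ≡ v

    isRep? : Decidable IsRep
    isRep? v = rep v ≟ v

    order : ℕ
    order = count isRep?

    Nontrivial : Set
    Nontrivial = ∃ λ u → ∃ λ v → rep u ≢ rep v

    RepC5 : (a b c d e : V) → Set
    RepC5 a b c d e = (IsRep a × IsRep b × IsRep c × IsRep d × IsRep e) × C5 a b c d e

    repC5? : Dec (∃ λ a → ∃ λ b → ∃ λ c → ∃ λ d → ∃ λ e → RepC5 a b c d e)
    repC5? = any? λ a → any? λ b → any? λ c → any? λ d → any? λ e →
      (isRep? a ×-dec isRep? b ×-dec isRep? c ×-dec isRep? d ×-dec isRep? e) ×-dec C5? a b c d e

    C5-free : Set
    C5-free = ∀ {a b c d e} → ¬ RepC5 a b c d e

    lift-adj : ∀ {b v} → IsRep b → rep v ≢ b → adj G v b ≡ adj G (rep v) b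
    lift-adj b≡ v≢b = trans (r-adj λ eq → v≢b (trans eq b≡)) (cong (adj G _) b≡)

    -- The bag conditions exclude that `rep v` is one of `b`, `c`, `d`, `e`, so adjacency to these
    -- passes from `rep v` to `v`. This keeps representatives of unbagged vertices unbagged when a
    -- buoy is contracted.
    lift-bag : ∀ {a b c d e v} → RepC5 a b c d e → InBag a b c d e (rep v) → InBag a b c d e v
    lift-bag ((_ , rb , rc , rd , re) , (_ , _ , cd , _)) (vb , ve , vc , vd) =
      trans (lift-adj rb (λ { refl → irrefl vb })) vb ,
      trans (lift-adj re (λ { refl → irrefl ve })) ve ,
      trans (lift-adj rc (λ { refl → ~⇒¬≁ cd vd })) vc ,
      trans (lift-adj rd (λ { refl → ~⇒¬≁ cd (≁-sym vc) })) vd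
      where
      irrefl : ∀ {x} → ¬ (x ~ x)
      irrefl xx = ~⇒¬≁ xx (adj-irr G _)

  rotateʳ : ∀ {q a b c d e} → Quotient.RepC5 q a b c d e → Quotient.RepC5 q b c d e a
  rotateʳ ((ra , rb , rc , rd , re) , z) = (rb , rc , rd , re , ra) , rotate z

  discrete : Quotient
  discrete = record { rep = id ; idem = λ _ → refl ; r-adj = λ _ → refl }

  BuoyOutcome PerfectOutcome : Set
  BuoyOutcome = Σ (V → Fin 5) λ τ →
    (∀ i → ∃ λ v → τ v ≡ i) × (∀ u v → τ u ≢ τ v → adj G u v ≡ c5Adj (τ u) (τ v))
  PerfectOutcome = Σ Quotient λ q → Quotient.Nontrivial q × Quotient.C5-free q

  module Merge (q : Quotient) {a b c d e : V} (Z : Quotient.RepC5 q a b c d e) where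
    open Quotient q
    z : C5 a b c d e
    z = proj₂ Z
    open Bags z public using (Bagged)
    open Bags z hiding (Bagged)

    bagged? : Decidable Bagged
    bagged? v = any? (λ i → bag? i v)

    lift-bagged : ∀ {v} → Bagged (rep v) → Bagged v
    lift-bagged (f0 , p) = f0 , lift-bag Z p
    lift-bagged (f1 , p) = f1 , lift-bag (rotateʳ {q} Z) p
    lift-bagged (f2 , p) = f2 , lift-bag (rotateʳ {q} (rotateʳ {q} Z)) p
    lift-bagged (f3 , p) = f3 , lift-bag (rotateʳ {q} (rotateʳ {q} (rotateʳ {q} Z))) p
    lift-bagged (f4 , p) = f4 , lift-bag (rotateʳ {q} (rotateʳ {q} (rotateʳ {q} (rotateʳ {q} Z)))) p

    bagged-none : ∀ {u x} → Bagged u → NoneAdj a b c d e x → u ≁ x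
    bagged-none (f0 , p) (xa , xb , xc , xd , xe) = none-bag z p (xa , xb , xc , xd , xe)
    bagged-none (f1 , p) (xa , xb , xc , xd , xe) = none-bag (rotate z) p (xb , xc , xd , xe , xa)
    bagged-none (f2 , p) (xa , xb , xc , xd , xe) = none-bag (rotate² z) p (xc , xd , xe , xa , xb)
    bagged-none (f3 , p) (xa , xb , xc , xd , xe) = none-bag (rotate³ z) p (xd , xe , xa , xb , xc)
    bagged-none (f4 , p) (xa , xb , xc , xd , xe) = none-bag (rotate⁴ z) p (xe , xa , xb , xc , xd)

    bagged-all : ∀ {u x} → Bagged u → AllAdj a b c d e x → u ~ x
    bagged-all (f0 , p) (xa , xb , xc , xd , xe) = all-bag z p (xa , xb , xc , xd , xe)
    bagged-all (f1 , p) (xa , xb , xc , xd , xe) = all-bag (rotate z) p (xb , xc , xd , xe , xa)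
    bagged-all (f2 , p) (xa , xb , xc , xd , xe) = all-bag (rotate² z) p (xc , xd , xe , xa , xb)
    bagged-all (f3 , p) (xa , xb , xc , xd , xe) = all-bag (rotate³ z) p (xd , xe , xa , xb , xc)
    bagged-all (f4 , p) (xa , xb , xc , xd , xe) = all-bag (rotate⁴ z) p (xe , xa , xb , xc , xd)

    bagged-module : ∀ {u v x} → Bagged u → Bagged v → ¬ Bagged x → adj G u x ≡ adj G v x
    bagged-module {x = x} bu bv ¬bx with classify x
    ... | inj₁ bx          = contradiction bx ¬bx
    ... | inj₂ (inj₁ none) = trans (bagged-none bu none) (sym (bagged-none bv none))
    ... | inj₂ (inj₂ full) = trans (bagged-all bu full) (sym (bagged-all bv full))

    bagged-a : Bagged a
    bagged-a = f0 , self z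

    -- Two positions of the cycle differ on some third one, and a vertex in both bags would be
    -- adjacent and nonadjacent to a member of that third bag.
    bag-unique : ∀ {i j v} → Bag i v → Bag j v → i ≡ j
    bag-unique {i} {j} p q with i ≟ j
    ... | yes i≡j = i≡j
    ... | no i≢j =
      let l , l≢i , l≢j , ne = c5-separates i j i≢j
          _ , r = bag-nonempty l
      in contradiction (trans (sym (bag-cross i l p r (≢-sym l≢i))) (bag-cross j l q r (≢-sym l≢j))) ne

    buoy : (∀ v → Bagged v) → BuoyOutcome
    buoy bagged = (λ v → proj₁ (bagged v)) ,
      (λ i → let x , p = bag-nonempty i in x , bag-unique (proj₂ (bagged x)) p) ,
      λ u v → bag-cross _ _ (proj₂ (bagged u)) (proj₂ (bagged v))

    -- `a` comes to represent the whole buoy. Every new representative is an old one and `b` is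
    -- lost, so the order drops, while the unbagged `x` keeps the quotient nontrivial.
    merged : (∃ λ x → ¬ Bagged x) → Σ Quotient λ q′ → Quotient.Nontrivial q′ × Quotient.order q′ < order
    merged (x , ¬bx) = q′ , (a , x , a≢x) , count-mono-< (λ v → new v ≟ v) isRep? smaller b rb b-lost
      where
      ra = proj₁ (proj₁ Z)
      rb = proj₁ (proj₂ (proj₁ Z))

      new : V → V
      new v with bagged? v
      ... | yes _ = a
      ... | no _  = rep v

      new-bagged : ∀ {v} → Bagged v → new v ≡ a
      new-bagged {v} bv with bagged? v
      ... | yes _  = refl
      ... | no ¬bv = contradiction bv ¬bv

      new-unbagged : ∀ {v} → ¬ Bagged v → new v ≡ rep v
      new-unbagged {v} ¬bv with bagged? v
      ... | yes bv = contradiction bv ¬bv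
      ... | no _   = refl

      rep≢a : ∀ {v} → ¬ Bagged v → rep v ≢ a
      rep≢a ¬bv eq = ¬bv (lift-bagged (subst Bagged (sym eq) bagged-a))

      new-idem : ∀ v → new (new v) ≡ new v
      new-idem v with bagged? v
      ... | yes _  = new-bagged bagged-a
      ... | no ¬bv = trans (new-unbagged (¬bv ∘ lift-bagged)) (idem v)

      outside : ∀ {u v} → Bagged u → ¬ Bagged v → adj G u v ≡ adj G a (rep v)
      outside bu ¬bv = trans (bagged-module bu bagged-a ¬bv)
        (trans (r-adj λ eq → rep≢a ¬bv (trans (sym eq) ra)) (cong (λ y → adj G y _) ra))

      new-adj : ∀ {u v} → new u ≢ new v → adj G u v ≡ adj G (new u) (new v)
      new-adj {u} {v} ne with bagged? u | bagged? v
      ... | yes _  | yes _  = contradiction refl ne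
      ... | yes bu | no ¬bv = outside bu ¬bv
      ... | no ¬bu | yes bv = trans (adj-sym G u v) (trans (outside bv ¬bu) (adj-sym G _ _))
      ... | no _   | no _   = r-adj ne

      q′ : Quotient
      q′ = record { rep = new ; idem = new-idem ; r-adj = new-adj }

      a≢x : new a ≢ new x
      a≢x eq = rep≢a ¬bx (trans (sym (new-unbagged ¬bx)) (trans (sym eq) (new-bagged bagged-a)))

      smaller : ∀ v → new v ≡ v → IsRep v
      smaller v eq with bagged? v
      ... | yes _ = trans (cong rep (sym eq)) (trans ra eq)
      ... | no _  = eq

      b-lost : new b ≢ b
      b-lost eq with proj₁ z
      ... | ab rewrite trans (sym (new-bagged (f1 , self (rotate z)))) eq = ~⇒¬≁ ab (adj-irr G b)

  decompose : (q : Quotient) → Quotient.Nontrivial q → BuoyOutcome ⊎ PerfectOutcome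
  decompose q = go q (<-wellFounded _)
    where
    go : ∀ q → Acc _<_ (Quotient.order q) → Quotient.Nontrivial q → BuoyOutcome ⊎ PerfectOutcome
    go q (acc smaller) nontrivial = split (Quotient.repC5? q)
      where
      absorb : ∀ {a b c d e} (Z : Quotient.RepC5 q a b c d e) →
        Dec (∀ v → Merge.Bagged q Z v) → BuoyOutcome ⊎ PerfectOutcome
      absorb Z (yes bagged) = inj₁ (Merge.buoy q Z bagged)
      absorb Z (no ¬all) =
        let q′ , nontrivial′ , lt = Merge.merged q Z (¬∀⟶∃¬ _ _ (Merge.bagged? q Z) ¬all)
        in go q′ (smaller lt) nontrivial′
      split : Dec (∃ λ a → ∃ λ b → ∃ λ c → ∃ λ d → ∃ λ e → Quotient.RepC5 q a b c d e) → BuoyOutcome ⊎ PerfectOutcome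
      split (yes (a , b , c , d , e , Z)) = absorb Z (all? (Merge.bagged? q Z))
      split (no ¬C5) = inj₂ (q , nontrivial , λ Z → ¬C5 (_ , _ , _ , _ , _ , Z))

-- Perfect orders

argmin : ∀ {n} (f : Fin (suc n) → ℕ) → ∃ λ i → ∀ j → f i ≤ f j
argmin {zero}  f = f0 , λ { f0 → ≤-refl }
argmin {suc n} f with argmin (f ∘ fs)
... | i , least-i with f f0 ≤? f (fs i)
... | yes le = f0 , λ { f0 → ≤-refl ; (fs j) → ≤-trans le (least-i j) }
... | no ¬le = fs i , λ { f0 → <⇒≤ (≰⇒> ¬le) ; (fs j) → least-i j }

-- Chvátal's theorem on perfect orders: elements of larger key come first, D is the domain of the order, and
-- adjacency E is reflexive, so that repeated elements behave as true twins.
module PerfectOrder {X : Set} (_≟ˣ_ : DecidableEquality X) (E : X → X → Set) (E? : ∀ x y → Dec (E x y))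
  (E-refl : ∀ {x} → E x x) (E-sym : ∀ {x y} → E x y → E y x) (key : X → ℕ) (D : X → Set)
  (no-obstruction : ∀ {a b c d} → D a → D b → D c → D d → E a b → E b c → E c d →
    ¬ E a c → ¬ E b d → ¬ E a d → key b ≤ key a → key c ≤ key d → ⊥) where

  open DecMembership _≟ˣ_ using (_∈?_)

  -- The claim that `p` also precedes some member of the clique is what carries the induction.
  -- Without the last member `w` there is a `p` preceding some `v`; without `v` there is a `q`. If
  -- `p` misses `w` and `q` misses `v`, then `p v w q` is an obstruction: `q` precedes some member,
  -- hence also the last one.
  clique-extension : ∀ {m} (Q : Fin (suc m) → X) {T : X → Set} → (∀ i → D (Q i)) → (∀ i j → E (Q i) (Q j)) →
    (∀ {p} → T p → D p) → (∀ {p q} → T p → T q → E p q → p ≡ q) →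
    (∀ i → ∃ λ p → T p × E p (Q i) × key (Q i) ≤ key p) →
    ∃ λ p → T p × (∀ i → E p (Q i)) × ∃ λ i → key (Q i) ≤ key p
  clique-extension {zero} Q dom clique T⊆D stable earlier with earlier f0
  ... | p , tp , pQ , le = p , tp , (λ { f0 → pQ }) , f0 , le
  clique-extension {suc m} Q {T} dom clique T⊆D stable earlier = result
    where
    without : ∀ i → ∃ λ p → T p × (∀ j → E p (Q (punchIn i j))) × ∃ λ j → key (Q (punchIn i j)) ≤ key p
    without i = clique-extension (Q ∘ punchIn i) (dom ∘ punchIn i) (λ _ _ → clique _ _) T⊆D stable (earlier ∘ punchIn i)

    elsewhere : ∀ {p} i → (∀ j → E p (Q (punchIn i j))) → ∀ {j} → i ≢ j → E p (Q j)
    elsewhere {p} i h i≢j = subst (E p ∘ Q) (punchIn-punchOut i≢j) (h (punchOut i≢j))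

    complete : ∀ {p} i → (∀ j → E p (Q (punchIn i j))) → E p (Q i) → ∀ j → E p (Q j)
    complete i h e j with i ≟ j
    ... | yes refl = e
    ... | no i≢j   = elsewhere i h i≢j

    result : ∃ λ p → T p × (∀ i → E p (Q i)) × ∃ λ i → key (Q i) ≤ key p
    result with argmin (key ∘ Q)
    ... | w , last with without w
    ... | p , tp , pQ , i , le with E? p (Q w)
    ... | yes e = p , tp , complete w pQ e , punchIn w i , le
    ... | no ¬pw with without (punchIn w i)
    ... | q , tq , qQ , j , le′ with E? q (Q (punchIn w i))
    ... | yes e = q , tq , complete _ qQ e , _ , le′
    ... | no ¬qv = ⊥-elim (no-obstruction (T⊆D tp) (dom _) (dom w) (T⊆D tq) (pQ i) (clique _ w)
      (E-sym (elsewhere _ qQ (punchInᵢ≢i w i))) ¬pw (¬qv ∘ E-sym)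
      (λ pq → ¬qv (subst (λ x → E x _) (stable tp tq pq) (pQ i))) le (≤-trans (last _) le′))

  record Greedy (L : List X) (S : List (X × ℕ)) : Set where
    field
      covers : ∀ {x} → x ∈ L → ∃ λ c → (x , c) ∈ S
      within : ∀ {x c} → (x , c) ∈ S → x ∈ L
      unique : ∀ {x c d} → (x , c) ∈ S → (x , d) ∈ S → c ≡ d
      proper : ∀ {x y c} → (x , c) ∈ S → (y , c) ∈ S → E x y → x ≡ y
      greedy : ∀ {x c i} → (x , c) ∈ S → i < c → ∃ λ p → (p , i) ∈ S × E p x × key x ≤ key p

  -- The tail is coloured before the head, so an ascending list is processed from the largest key
  -- down.
  greedy-colouring : ∀ {L} → AllPairs (λ x y → key x ≤ key y) L → ∃ (Greedy L)
  greedy-colouring [] = [] , record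
    { covers = λ () ; within = λ () ; unique = λ () ; proper = λ () ; greedy = λ () }
  greedy-colouring {x ∷ L} (x≤ ∷ sorted) with greedy-colouring sorted | x ∈? L
  ... | S , g | yes x∈L = S , record
    { covers = λ { (here refl) → covers x∈L ; (there y∈L) → covers y∈L }
    ; within = there ∘ within ; unique = unique ; proper = proper ; greedy = greedy }
    where open Greedy g
  ... | S , g | no x∉L with least (λ c → ¬? (blocked? c)) (fresh S) (fresh-free S)
    where
    Blocked : ℕ → Set
    Blocked c = Any.Any (λ (y , d) → d ≡ c × E y x) S
    blocked? : Decidable Blocked
    blocked? c = Any.any? (λ (y , d) → (d ℕ.≟ c) ×-dec E? y x) S
    -- Exceeds every colour in the list and so bounds the search for the least colour that is not
    -- blocked.
    fresh : List (X × ℕ) → ℕ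
    fresh []            = 0
    fresh ((_ , d) ∷ S) = suc d + fresh S
    fresh-bound : ∀ {S y d} → (y , d) ∈ S → d < fresh S
    fresh-bound (here refl) = m≤m+n _ _
    fresh-bound {(_ , d) ∷ S} (there m) = ≤-trans (fresh-bound m) (m≤n+m _ (suc d))
    fresh-free : ∀ S → ¬ Any.Any (λ (y , d) → d ≡ fresh S × E y x) S
    fresh-free S b with find b
    ... | _ , m , refl , _ = <-irrefl refl (fresh-bound m)
  ... | c , free , below = (x , c) ∷ S , record
    { covers = λ { (here refl) → c , here refl ; (there y∈L) → let d , m = covers y∈L in d , there m }
    ; within = λ { (here refl) → here refl ; (there m) → there (within m) }
    ; unique = λ { (here refl) (here refl) → refl ; (here refl) (there m) → contradiction (within m) x∉L
                 ; (there m) (here refl) → contradiction (within m) x∉L ; (there m) (there m′) → unique m m′ }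
    ; proper = λ { (here refl) (here refl) _ → refl
                 ; (here refl) (there m) e → contradiction (lose m (refl , E-sym e)) free
                 ; (there m) (here refl) e → contradiction (lose m (refl , e)) free
                 ; (there m) (there m′) e → proper m m′ e }
    ; greedy = λ { (here refl) i<c → earlier (below _ i<c)
                 ; (there m) i<c → let p , m′ , r = greedy m i<c in p , there m′ , r }
    }
    where
    open Greedy g
    earlier : ∀ {i} → ¬ ¬ Any.Any (λ (y , d) → d ≡ i × E y x) S →
      ∃ λ p → (p , i) ∈ (x , c) ∷ S × E p x × key x ≤ key p
    earlier {i} ¬¬b with find (decidable-stable (Any.any? (λ (y , d) → (d ℕ.≟ i) ×-dec E? y x) S) ¬¬b)
    ... | (y , _) , m , refl , e = y , there m , e , All.lookup x≤ (within m)

  module _ {L S} (g : Greedy L S) (L⊆D : ∀ {x} → x ∈ L → D x) where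
    open Greedy g

    RainbowClique : ℕ → ℕ → Set
    RainbowClique i n = Σ (Fin n → X) λ Q → (∀ j → (Q j , i + toℕ j) ∈ S) × (∀ j j′ → E (Q j) (Q j′))

    -- All members have colours above the next one to be added, so greediness gives each an earlier
    -- neighbour of that colour. The colour class is stable, and `clique-extension` finds in it one
    -- vertex adjacent to all.
    extend-rainbow : ∀ i {m} → RainbowClique i (suc m) → RainbowClique 0 (i + suc m)
    extend-rainbow zero Q = Q
    extend-rainbow (suc i) {m} (Q , coloured , clique) =
      let p , p∈ , pQ , _ = clique-extension Q {λ p → (p , i) ∈ S} (L⊆D ∘ within ∘ coloured) clique
            (L⊆D ∘ within) proper (λ j → greedy (coloured j) (s≤s (m≤m+n i (toℕ j))))
      in subst (RainbowClique 0) (+-suc i (suc m)) (extend-rainbow i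
        ( p ◂ Q
        , (λ { f0 → subst (λ c → (p , c) ∈ S) (sym (+-identityʳ i)) p∈
             ; (fs j) → subst (λ c → (Q j , c) ∈ S) (sym (+-suc i (toℕ j))) (coloured j) })
        , (λ { f0 f0 → E-refl ; f0 (fs j) → pQ j ; (fs j) f0 → E-sym (pQ j) ; (fs j) (fs j′) → clique j j′ })))

    rainbow-clique : ∀ {x c} → (x , c) ∈ S → RainbowClique 0 (c + 1)
    rainbow-clique {x} {c} m = extend-rainbow c {0}
      ((λ _ → x) , (λ { f0 → subst (λ d → (x , d) ∈ S) (sym (+-identityʳ c)) m }) , λ _ _ → E-refl)

-- The degree order on C5-free quotients

ind-exchange : {A B C D : Set} {A? : Dec A} {B? : Dec B} {C? : Dec C} {D? : Dec D} →
  (A → B ⊎ C) → (D → B ⊎ C) → (A → D → B × C) → ind A? + ind D? ≤ ind B? + ind C?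
ind-exchange {A? = no _}  {D? = no _} f g h = z≤n
ind-exchange {A? = yes a} {yes _} {D? = no _} f g h = s≤s z≤n
ind-exchange {A? = yes a} {no ¬b} {yes _} {no _} f g h = ≤-refl
ind-exchange {A? = yes a} {no ¬b} {no ¬c} f g h = contradiction (f a) [ ¬b , ¬c ]′
ind-exchange {A? = no _}  {yes _} {D? = yes d} f g h = s≤s z≤n
ind-exchange {A? = no _}  {no ¬b} {yes _} {yes d} f g h = ≤-refl
ind-exchange {A? = no _}  {no ¬b} {no ¬c} {yes d} f g h = contradiction (g d) [ ¬b , ¬c ]′
ind-exchange {A? = yes a} {yes _} {yes _} {yes d} f g h = ≤-refl
ind-exchange {A? = yes a} {no ¬b} {D? = yes d} f g h = contradiction (proj₁ (h a d)) ¬b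
ind-exchange {A? = yes a} {B? = B?} {no ¬c} {yes d} f g h = contradiction (proj₂ (h a d)) ¬c

ind-exchange-< : {A B C D : Set} {A? : Dec A} {B? : Dec B} {C? : Dec C} {D? : Dec D} →
  ¬ A → ¬ D → B → ind A? + ind D? < ind B? + ind C?
ind-exchange-< {A? = yes a} ¬a ¬d b = contradiction a ¬a
ind-exchange-< {A? = no _} {D? = yes d} ¬a ¬d b = contradiction d ¬d
ind-exchange-< {A? = no _} {no ¬b} ¬a ¬d b = contradiction b ¬b
ind-exchange-< {A? = no _} {yes _} {D? = no _} ¬a ¬d b = s≤s z≤n

module PerfectQuotient (G : Graph) (free : P5coP5Free G) (q : Quotients.Quotient G free)
  (noC5 : Quotients.Quotient.C5-free q) where
  open Colouring G
  open FreeGraph G free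
  open Quotients.Quotient q

  P4 : (a b c d : V) → Set
  P4 a b c d = a ~ b × b ~ c × c ~ d × a ≁ c × b ≁ d × a ≁ d

  reverse : ∀ {a b c d} → P4 a b c d → P4 d c b a
  reverse (ab , bc , cd , ac , bd , ad) = ~-sym cd , ~-sym bc , ~-sym ab , ≁-sym bd , ≁-sym ac , ≁-sym ad

  module _ {a b c d x} (ra : IsRep a) (rb : IsRep b) (rc : IsRep c) (rd : IsRep d) (rx : IsRep x) where

    -- Otherwise `x` closes `a b c d` to a C5 of representatives or prolongs it to a P5. This is
    -- where C5-freeness of the quotient enters.
    end-middle : P4 a b c d → x ~ a → x ~ b ⊎ x ~ c
    end-middle (ab , bc , cd , ac , bd , ad) xa with adjacent? x b | adjacent? x c | adjacent? x d
    ... | inj₁ xb | _       | _       = inj₁ xb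
    ... | inj₂ _  | inj₁ xc | _       = inj₂ xc
    ... | inj₂ xb | inj₂ xc | inj₂ xd = ⊥-elim (no-P5 xa ab bc cd xb ac bd xc ad xd)
    ... | inj₂ xb | inj₂ xc | inj₁ xd =
      ⊥-elim (noC5 ((rx , ra , rb , rc , rd) , (xa , ab , bc , cd , ~-sym xd , xb , ac , bd , ≁-sym xc , ≁-sym ad)))

    ends-middle : P4 a b c d → x ~ a → x ~ d → x ~ b
    ends-middle p@(ab , bc , cd , ac , bd , ad) xa xd with adjacent? x b | end-middle p xa
    ... | inj₁ xb | _       = xb
    ... | inj₂ xb | inj₁ xb′ = xb′
    ... | inj₂ xb | inj₂ xc = ⊥-elim (no-house xb bd (≁-sym ad) ac xd (~-sym ab) (~-sym cd) xa bc xc)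

  RepNeighbour : V → V → Set
  RepNeighbour v x = IsRep x × x ~ v

  repNeighbour? : ∀ v → Decidable (RepNeighbour v)
  repNeighbour? v x = isRep? x ×-dec (adj G x v Bool.≟ true)

  degree : V → ℕ
  degree v = count (repNeighbour? v)

  -- Every representative has at least as many neighbours among b, c as among a, d, and a itself has more.
  P4-degree : ∀ {a b c d} → IsRep a → IsRep b → IsRep c → IsRep d → P4 a b c d →
    degree a + degree d < degree b + degree c
  P4-degree {a} {b} {c} {d} ra rb rc rd p@(ab , _ , _ , _ , _ , ad) =
    subst₂ _<_
      (∑-distrib-+ (ind ∘ repNeighbour? a) (ind ∘ repNeighbour? d))
      (∑-distrib-+ (ind ∘ repNeighbour? b) (ind ∘ repNeighbour? c))
      (∑-mono-< {f = λ x → ind (repNeighbour? a x) + ind (repNeighbour? d x)} pointwise a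
        (ind-exchange-< {A? = repNeighbour? a a} {repNeighbour? b a} {repNeighbour? c a} {repNeighbour? d a}
          (λ (_ , aa) → ~⇒¬≁ aa (adj-irr G a)) (λ (_ , ad′) → ~⇒¬≁ ad′ ad) (ra , ab)))
    where
    pointwise : ∀ x → ind (repNeighbour? a x) + ind (repNeighbour? d x) ≤ ind (repNeighbour? b x) + ind (repNeighbour? c x)
    pointwise x = ind-exchange {A? = repNeighbour? a x} {repNeighbour? b x} {repNeighbour? c x} {repNeighbour? d x}
      (λ (rx , xa) → [ (λ xb → inj₁ (rx , xb)) , (λ xc → inj₂ (rx , xc)) ]′ (end-middle ra rb rc rd rx p xa))
      (λ (rx , xd) → [ (λ xc → inj₂ (rx , xc)) , (λ xb → inj₁ (rx , xb)) ]′ (end-middle rd rc rb ra rx (reverse p) xd))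
      (λ (rx , xa) (_ , xd) → (rx , ends-middle ra rb rc rd rx p xa xd) ,
        (rx , ends-middle rd rc rb ra rx (reverse p) xd xa))

  X : Set
  X = V × ℕ

  E : X → X → Set
  E (u , _) (v , _) = u ≡ v ⊎ u ~ v

  E? : ∀ x y → Dec (E x y)
  E? (u , _) (v , _) = (u ≟ v) ⊎-dec (adj G u v Bool.≟ true)

  E-refl : ∀ {x} → E x x
  E-refl = inj₁ refl

  E-sym : ∀ {x y} → E x y → E y x
  E-sym = [ inj₁ ∘ sym , inj₂ ∘ ~-sym ]′

  key : X → ℕ
  key (v , _) = degree v

  D : X → Set
  D (v , _) = IsRep v

  -- Equal originals would contradict one of the missing adjacencies, so the four originals form a
  -- P4 and `P4-degree` applies.
  no-obstruction : ∀ {a b c d} → D a → D b → D c → D d → E a b → E b c → E c d →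
    ¬ E a c → ¬ E b d → ¬ E a d → key b ≤ key a → key c ≤ key d → ⊥
  no-obstruction ra rb rc rd ab bc cd ¬ac ¬bd ¬ad ba cd′ = <⇒≱
    (P4-degree ra rb rc rd
      ( [ (λ { refl → contradiction bc ¬ac }) , id ]′ ab
      , [ (λ { refl → contradiction ab ¬ac }) , id ]′ bc
      , [ (λ { refl → contradiction bc ¬bd }) , id ]′ cd
      , non ¬ac , non ¬bd , non ¬ad))
    (+-mono-≤ ba cd′)
    where
    non : ∀ {u v} → ¬ (u ≡ v ⊎ u ~ v) → u ≁ v
    non {u} {v} ¬e with adjacent? u v
    ... | inj₁ uv = contradiction (inj₂ uv) ¬e
    ... | inj₂ uv = uv

  _≟ˣ_ : (x y : X) → Dec (x ≡ y)
  _≟ˣ_ = ≡-dec _≟_ ℕ._≟_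

  open PerfectOrder _≟ˣ_ E E? (λ {x} → E-refl {x}) (λ {x} {y} → E-sym {x} {y}) key D
    (λ {a} {b} {c} {d} → no-obstruction {a} {b} {c} {d})

  open Substitution rep _≟_

  class? : ∀ v → Decidable (Part v)
  class? v u = rep u ≟ v

  weight : V → ℕ
  weight v = proj₁ (chromatic (class? v))

  class-colours : ∀ v → ColOn (Part v) (weight v)
  class-colours v = proj₁ (proj₂ (chromatic (class? v)))

  class-needs : ∀ v → Needs (Part v) (weight v)
  class-needs v = proj₂ (proj₂ (chromatic (class? v)))

  -- By `idem` a vertex that is not its own representative has an empty class, which needs no
  -- colour.
  weight>0⇒rep : ∀ {v j} → j < weight v → IsRep v
  weight>0⇒rep {v} j<w with isRep? v
  ... | yes rv = rv
  ... | no ¬rv = contradiction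
    ((λ _ → 0) , (λ { u refl → contradiction (idem u) ¬rv }) , (λ { u _ refl → contradiction (idem u) ¬rv }))
    (class-needs v 0 (≤-<-trans z≤n j<w))

  -- Each representative v occurs as many times as its class needs colours.
  expansion : List X
  expansion = concatMap (λ v → map (v ,_) (upTo (weight v))) (allFin (size G))

  ∈-expansion⁺ : ∀ {v j} → j < weight v → (v , j) ∈ expansion
  ∈-expansion⁺ {v} j<w = ∈-concatMap⁺ _ (Any.map (λ { refl → ∈-map⁺ (v ,_) (∈-upTo⁺ j<w) }) (∈-allFin v))

  ∈-expansion⁻ : ∀ {v j} → (v , j) ∈ expansion → j < weight v
  ∈-expansion⁻ m with find (∈-concatMap⁻ (λ v → map (v ,_) (upTo (weight v))) {xs = allFin (size G)} m)
  ... | u , _ , m′ with ∈-map⁻ (u ,_) m′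
  ... | _ , j∈ , refl = ∈-upTo⁻ j∈

  open Sort (On.decTotalOrder ≤-decTotalOrder key) using (sort; sort-↭; sort-↗)

  sorted : AllPairs (λ x y → key x ≤ key y) (sort expansion)
  sorted = Linked⇒AllPairs ≤-trans (sort-↗ expansion)

  abstract
    S : List (X × ℕ)
    S = proj₁ (greedy-colouring sorted)

    S-greedy : Greedy (sort expansion) S
    S-greedy = proj₂ (greedy-colouring sorted)

  open Greedy S-greedy

  weight-bound : ∀ {v j} → (v , j) ∈ sort expansion → j < weight v
  weight-bound m = ∈-expansion⁻ (∈-resp-↭ (sort-↭ expansion) m)

  covered : ∀ {v j} → j < weight v → ∃ λ c → ((v , j) , c) ∈ S
  covered j<w = covers (∈-resp-↭ (↭-sym (sort-↭ expansion)) (∈-expansion⁺ j<w))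

  -- The colours of the copies of a representative serve as the palette of its class. They differ
  -- because copies are twins, and palettes of adjacent classes are disjoint because their copies
  -- are adjacent.
  expansion-colouring : ∀ {K} → (∀ {x c} → (x , c) ∈ S → c < K) → ColOn All K
  expansion-colouring {K} low = colour-parts weight
    (λ v → ColOn-⊆ (λ _ → proj₂) (class-colours v)) pal
    (λ v j<w → low (pal∈ v j<w))
    (λ v p q eq → cong proj₂ (proper (pal∈ v p) (subst (λ c → (_ , c) ∈ S) (sym eq) (pal∈ v q)) (inj₁ refl)))
    (λ u v _ _ uv neq p q eq → neq (cong proj₁ (proper (pal∈ (rep u) p)
      (subst (λ c → (_ , c) ∈ S) (sym eq) (pal∈ (rep v) q)) (inj₂ (trans (sym (r-adj neq)) uv)))))
    where
    pal : V → ℕ → ℕ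
    pal v j with j <? weight v
    ... | yes j<w = proj₁ (covered j<w)
    ... | no _    = 0
    pal∈ : ∀ v {j} → j < weight v → ((v , j) , pal v j) ∈ S
    pal∈ v {j} j<w with j <? weight v
    ... | yes j<w′ = proj₂ (covered j<w′)
    ... | no ¬j<w  = contradiction j<w ¬j<w

  -- The class of v shows at least weight v colours, so the member (v , j) of the clique can be sent to the
  -- j-th of them; distinct classes of a clique are complete to each other and share no colour.
  clique-bound : ∀ {K N z} → IsRep z → ColOn (All − z) K → (Q : Fin N → X) →
    (∀ i → proj₂ (Q i) < weight (proj₁ (Q i))) →
    Injective _≡_ _≡_ Q → (∀ i j → E (Q i) (Q j)) → (∀ i → proj₁ (Q i) ≢ z) → N ≤ K
  clique-bound {K} {N} {z} rz C Q in-range Q-inj clique avoid = injective⇒≤ {f = F} F-inj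
    where
    module Cl (v : V) (v≢z : v ≢ z) where
      class⊆ : ∀ u → Part v u → (All − z) u
      class⊆ u refl = tt , λ { refl → v≢z rz }
      open Used (class? v) (ColOn-⊆ class⊆ C) public using (Needs⇒≤; module Palette)
      open Palette (Needs⇒≤ (class-needs v)) public
    colour : Fin N → ℕ
    colour i = Cl.palette _ (avoid i) (proj₂ (Q i))
    used : ∀ i → colour i < K × (∃ λ u → Part (proj₁ (Q i)) u × proj₁ C u ≡ colour i)
    used i = Cl.palette-used _ (avoid i) (in-range i)
    F : Fin N → Fin K
    F i = fromℕ< (proj₁ (used i))
    same : ∀ {v v′ j j′} (p : v ≢ z) (p′ : v′ ≢ z) → v ≡ v′ → j < weight v → j′ < weight v′ →
      Cl.palette v p j ≡ Cl.palette v′ p′ j′ → (v , j) ≡ (v′ , j′)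
    same p p′ refl lt lt′ eq = cong (_ ,_) (Cl.palette-inj _ p lt lt′ eq)
    F-inj : Injective _≡_ _≡_ F
    F-inj {i} {j} eq = case (clique i j)
      where
      colours≡ : colour i ≡ colour j
      colours≡ = trans (sym (toℕ-fromℕ< _)) (trans (cong toℕ eq) (toℕ-fromℕ< _))
      case : E (Q i) (Q j) → i ≡ j
      case (inj₁ v≡) = Q-inj (same (avoid i) (avoid j) v≡ (in-range i) (in-range j) colours≡)
      case (inj₂ vv′) =
        let _ , u , pu , cu = used i
            _ , u′ , pu′ , cu′ = used j
            uu′ = trans (r-adj λ eq′ → ~⇒¬≁ vv′
                    (trans (cong (λ y → adj G y (proj₁ (Q j))) (trans (sym pu) (trans eq′ pu′))) (adj-irr G _)))
                    (trans (cong₂ (adj G) pu pu′) vv′)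
        in contradiction (trans cu (trans colours≡ (sym cu′)))
             (proj₂ (proj₂ C) u u′ (Cl.class⊆ _ (avoid i) u pu) (Cl.class⊆ _ (avoid j) u′ pu′) uu′)

  -- The greedy colouring cannot do with fewer colours than G, so it yields a clique of at least k
  -- copies. If this had no copy of a representative `z`, it would be bounded by a colouring of G -
  -- z with k - 1 colours. So every representative occurs in the clique.
  reps-adjacent : ∀ {k} → 1 ≤ k → CritOn All k → ∀ {u v} → IsRep u → IsRep v → u ≢ v → u ~ v
  reps-adjacent {suc k} _ (_ , minimal , critical) ru rv u≢v =
    let i , iu = hit ru
        j , jv = hit rv
    in [ (λ eq → contradiction (trans (sym iu) (trans eq jv)) u≢v) , subst₂ _~_ iu jv ]′ (clique i j)
    where
    high : Any.Any (λ (_ , c) → k ≤ c) S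
    high = decidable-stable (Any.any? (λ (_ , c) → k ≤? c) S) λ ¬high →
      minimal k (n<1+n k) (expansion-colouring λ m → ≰⇒> (λ k≤c → ¬high (lose m k≤c)))
    c : ℕ
    c = proj₂ (proj₁ (find high))
    rainbow : RainbowClique S-greedy (weight>0⇒rep ∘ weight-bound) 0 (c + 1)
    rainbow = rainbow-clique S-greedy (weight>0⇒rep ∘ weight-bound) (proj₁ (proj₂ (find high)))
    Q : Fin (c + 1) → X
    Q = proj₁ rainbow
    coloured : ∀ j → (Q j , toℕ j) ∈ S
    coloured = proj₁ (proj₂ rainbow)
    clique : ∀ i j → E (Q i) (Q j)
    clique = proj₂ (proj₂ rainbow)
    Q-inj : Injective _≡_ _≡_ Q
    Q-inj {i} {j} eq = toℕ-injective (unique (coloured i) (subst (λ x → (x , toℕ j) ∈ S) (sym eq) (coloured j)))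
    hit : ∀ {z} → IsRep z → ∃ λ i → proj₁ (Q i) ≡ z
    hit {z} rz = decidable-stable (any? (λ i → proj₁ (Q i) ≟ z)) λ ¬h →
      <⇒≱ (subst (k <_) (+-comm 1 c) (s≤s (proj₂ (proj₂ (find high)))))
        (clique-bound rz (critical z tt) Q (weight-bound ∘ within ∘ coloured) Q-inj clique (λ i eq → ¬h (i , eq)))

  join-partition : ∀ {k} → 1 ≤ k → CritOn All k → Nontrivial → Σ (V → Bool) λ τ →
    (∀ b → ∃ λ v → τ v ≡ b) × (∀ u v → τ u ≢ τ v → adj G u v ≡ true)
  join-partition 1≤k crit (x , y , x≢y) = τ ,
    (λ { true → x , dec-true (rep x ≟ rep x) refl ; false → y , dec-false (rep y ≟ rep x) (≢-sym x≢y) }) ,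
    λ u v neq → let ne = λ eq → neq (cong (λ w → does (w ≟ rep x)) eq) in
      trans (r-adj ne) (reps-adjacent 1≤k crit (idem u) (idem v) ne)
    where
    τ : V → Bool
    τ v = does (rep v ≟ rep x)

-- Freeness of compositions

Consistent : {I : Set} → (Fin 5 → Fin 5 → Bool) → (I → I → Bool) → (Fin 5 → I) → Set
Consistent F R t = ∀ i j → t i ≡ t j ⊎ F i j ≡ R (t i) (t j)

-- Primality of `F` and its absence from `R` in one condition: a copy of `F` in a composition along
-- `R` lies in a single part. Quantifying over five values instead of a function makes it decidable
-- by plain search.
Indecomposable : {I : Set} → (I → I → Bool) → (Fin 5 → Fin 5 → Bool) → Set
Indecomposable {I} R F = ∀ (s₀ s₁ s₂ s₃ s₄ : I) → let s = s₀ ◂ s₁ ◂ s₂ ◂ s₃ ◂ s₄ ◂ ⟨⟩ in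
  Consistent F R s → ∀ i → s i ≡ s f0

indecomposable? : {I : Set} → DecidableEquality I → (∀ {P : I → Set} → Decidable P → Dec (∀ x → P x)) →
  ∀ R F → Dec (Indecomposable {I} R F)
indecomposable? _≟ᴵ_ all R F = all λ s₀ → all λ s₁ → all λ s₂ → all λ s₃ → all λ s₄ →
  let s = s₀ ◂ s₁ ◂ s₂ ◂ s₃ ◂ s₄ ◂ ⟨⟩ in
  (all? λ i → all? λ j → (s i ≟ᴵ s j) ⊎-dec (F i j Bool.≟ R (s i) (s j))) →-dec all? λ i → s i ≟ᴵ s f0

all-Bool? : {P : Bool → Set} → Decidable P → Dec (∀ b → P b)
all-Bool? P? = map′ (λ (p , q) → λ { true → p ; false → q }) (λ h → h true , h false) (P? true ×-dec P? false)

join-pattern : Bool → Bool → Bool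
join-pattern _ _ = true

P5-join : Indecomposable join-pattern (adj P5)
P5-join = from-yes (indecomposable? Bool._≟_ all-Bool? join-pattern (adj P5))

coP5-join : Indecomposable join-pattern (adj coP5)
coP5-join = from-yes (indecomposable? Bool._≟_ all-Bool? join-pattern (adj coP5))

P5-buoy : Indecomposable c5Adj (adj P5)
P5-buoy = from-yes (indecomposable? _≟_ all? c5Adj (adj P5))

coP5-buoy : Indecomposable c5Adj (adj coP5)
coP5-buoy = from-yes (indecomposable? _≟_ all? c5Adj (adj coP5))

module Composition (G : Graph) {I : Set} (τ : Fin (size G) → I) (_≟ᴵ_ : DecidableEquality I) (R : I → I → Bool)
  (cross : ∀ u v → τ u ≢ τ v → adj G u v ≡ R (τ u) (τ v)) where
  open Colouring G
  open Substitution τ _≟ᴵ_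

  module _ {H : I → Graph} (E : ∀ i → Embedding (H i) (Part i)) where

    copy-in-part : (F : Fin 5 → Fin 5 → Bool) → Indecomposable R F → (f : Fin 5 → V) → Injective _≡_ _≡_ f →
      (∀ i j → F i j ≡ adj G (f i) (f j)) →
      Σ (Fin 5 → Fin (size (H (τ (f f0))))) λ g → Injective _≡_ _≡_ g ×
        (∀ i j → F i j ≡ adj (H (τ (f f0))) (g i) (g j))
    copy-in-part F indec f f-inj f-adj = g ,
      (λ eq → f-inj (trans (sym (emb-back (same _))) (trans (cong emb eq) (emb-back (same _))))) ,
      λ i j → trans (f-adj i j) (sym (trans (emb-adj (g i) (g j))
        (cong₂ (adj G) (emb-back (same i)) (emb-back (same j)))))
      where
      open Embedding (E (τ (f f0)))
      consistent : Consistent F R (τ ∘ f)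
      consistent i j with τ (f i) ≟ᴵ τ (f j)
      ... | yes eq = inj₁ eq
      ... | no neq = inj₂ (trans (f-adj i j) (cross (f i) (f j) neq))
      -- The tuple form that `Indecomposable` expects, which agrees with `τ ∘ f` pointwise.
      t : Fin 5 → I
      t = τ (f f0) ◂ τ (f f1) ◂ τ (f f2) ◂ τ (f f3) ◂ τ (f f4) ◂ ⟨⟩
      t≗ : ∀ i → t i ≡ τ (f i)
      t≗ f0 = refl
      t≗ f1 = refl
      t≗ f2 = refl
      t≗ f3 = refl
      t≗ f4 = refl
      same : ∀ i → τ (f i) ≡ τ (f f0)
      same i = trans (sym (t≗ i)) (indec _ _ _ _ _ (λ i j →
        subst₂ (λ x y → x ≡ y ⊎ F i j ≡ R x y) (sym (t≗ i)) (sym (t≗ j)) (consistent i j)) i)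
      g : Fin 5 → Fin (size (H (τ (f f0))))
      g i = back (same i)

    composition-free : Indecomposable R (adj P5) → Indecomposable R (adj coP5) →
      (∀ i → P5coP5Free (H i)) → P5coP5Free G
    composition-free indec₁ indec₂ free =
      (λ (f , f-inj , f-adj) → proj₁ (free _) (copy-in-part (adj P5) indec₁ f f-inj f-adj)) ,
      (λ (f , f-inj , f-adj) → proj₂ (free _) (copy-in-part (adj coP5) indec₂ f f-inj f-adj))

-- Sufficiency of the two constructions

module Backward (G : Graph) where
  open Colouring G
  open CriticalParts G

  module JoinBackward {H₁ H₂ : Graph} (join : IsJoin G H₁ H₂) where
    φ-adj = proj₂ join
    open Inverse (proj₁ join) using (to; from; strictlyInverseˡ; strictlyInverseʳ)

    side : Fin (size H₁) ⊎ Fin (size H₂) → Bool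
    side (inj₁ _) = true
    side (inj₂ _) = false

    τ : V → Bool
    τ v = side (to v)

    from-adj : ∀ x y → adj G (from x) (from y) ≡ joinAdj H₁ H₂ x y
    from-adj x y = trans (φ-adj (from x) (from y)) (cong₂ (joinAdj H₁ H₂) (strictlyInverseˡ x) (strictlyInverseˡ y))

    cross : ∀ u v → τ u ≢ τ v → adj G u v ≡ true
    cross u v neq = trans (φ-adj u v) (mixed (to u) (to v) neq)
      where
      mixed : ∀ x y → side x ≢ side y → joinAdj H₁ H₂ x y ≡ true
      mixed (inj₁ _) (inj₁ _) neq = contradiction refl neq
      mixed (inj₂ _) (inj₂ _) neq = contradiction refl neq
      mixed (inj₁ _) (inj₂ _) _   = refl
      mixed (inj₂ _) (inj₁ _) _   = refl

    from-inj : ∀ {x y} → from x ≡ from y → x ≡ y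
    from-inj eq = trans (sym (strictlyInverseˡ _)) (trans (cong to eq) (strictlyInverseˡ _))

    H : Bool → Graph
    H true  = H₁
    H false = H₂

    inject : ∀ b → Fin (size (H b)) → Fin (size H₁) ⊎ Fin (size H₂)
    inject true  = inj₁
    inject false = inj₂

    inject-inj : ∀ b {i j} → inject b i ≡ inject b j → i ≡ j
    inject-inj true  refl = refl
    inject-inj false refl = refl

    inject-adj : ∀ b i j → adj (H b) i j ≡ joinAdj H₁ H₂ (inject b i) (inject b j)
    inject-adj true  _ _ = refl
    inject-adj false _ _ = refl

    side-inject : ∀ b i → side (inject b i) ≡ b
    side-inject true  _ = refl
    side-inject false _ = refl

    project : ∀ b x → side x ≡ b → ∃ λ i → inject b i ≡ x
    project true  (inj₁ i) refl = i , refl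
    project false (inj₂ i) refl = i , refl

    open PartColours τ Bool._≟_ using (Part)

    side-embedding : ∀ b → Embedding (H b) (Part b)
    side-embedding b = record
      { emb      = from ∘ inject b
      ; emb-inj  = inject-inj b ∘ from-inj
      ; emb-adj  = λ i j → trans (inject-adj b i j) (sym (from-adj (inject b i) (inject b j)))
      ; emb-in   = λ i → trans (cong side (strictlyInverseˡ (inject b i))) (side-inject b i)
      ; back     = λ p → proj₁ (project b _ p)
      ; emb-back = λ p → trans (cong from (proj₂ (project b _ p))) (strictlyInverseʳ _)
      }

  join⇒InC : ∀ {k} → JoinConstruction k G → InC k G
  join⇒InC (k₁ , k₂ , 1≤k₁ , 1≤k₂ , refl , H₁ , H₂ , (crit₁ , free₁) , (crit₂ , free₂) , join) =
    CritOn⇒Critical self-embedding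
      (join-critical (λ { true → k₁ ; false → k₂ }) (λ { true → 1≤k₁ ; false → 1≤k₂ })
        λ { true → Critical⇒CritOn (part? true) (side-embedding true) crit₁
          ; false → Critical⇒CritOn (part? false) (side-embedding false) crit₂ }) ,
    Composition.composition-free G τ Bool._≟_ join-pattern cross side-embedding P5-join coP5-join
      λ { true → free₁ ; false → free₂ }
    where
    open JoinBackward join
    open JoinPartition τ cross

  module BuoyBackward {B : Fin 5 → Graph} (buoy : IsBuoy G B) where
    φ-adj = proj₂ (proj₂ buoy)
    open Inverse (proj₁ (proj₂ buoy)) using (to; from; strictlyInverseˡ; strictlyInverseʳ)

    τ : V → Fin 5
    τ v = proj₁ (to v)

    from-adj : ∀ x y → adj G (from x) (from y) ≡ buoyAdj B x y
    from-adj x y = trans (φ-adj (from x) (from y)) (cong₂ (buoyAdj B) (strictlyInverseˡ x) (strictlyInverseˡ y))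

    buoyAdj-within : ∀ i a b → buoyAdj B (i , a) (i , b) ≡ adj (B i) a b
    buoyAdj-within i a b with i ≟ i
    ... | yes refl = refl
    ... | no i≢i   = contradiction refl i≢i

    buoyAdj-across : ∀ x y → proj₁ x ≢ proj₁ y → buoyAdj B x y ≡ c5Adj (proj₁ x) (proj₁ y)
    buoyAdj-across (i , a) (j , b) i≢j with i ≟ j
    ... | yes i≡j = contradiction i≡j i≢j
    ... | no _    = refl

    cross : ∀ u v → τ u ≢ τ v → adj G u v ≡ c5Adj (τ u) (τ v)
    cross u v neq = trans (φ-adj u v) (buoyAdj-across (to u) (to v) neq)

    from-inj : ∀ {x y} → from x ≡ from y → x ≡ y
    from-inj eq = trans (sym (strictlyInverseˡ _)) (trans (cong to eq) (strictlyInverseˡ _))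

    pair-inj : ∀ {i} {a b : Fin (size (B i))} → _≡_ {A = BuoyVertex B} (i , a) (i , b) → a ≡ b
    pair-inj refl = refl

    project : ∀ {i} (x : BuoyVertex B) → proj₁ x ≡ i → ∃ λ a → (i , a) ≡ x
    project (i , a) refl = a , refl

    open PartColours τ _≟_ using (Part)

    bag-embedding : ∀ i → Embedding (B i) (Part i)
    bag-embedding i = record
      { emb      = λ a → from (i , a)
      ; emb-inj  = pair-inj ∘ from-inj
      ; emb-adj  = λ a b → trans (sym (buoyAdj-within i a b)) (sym (from-adj (i , a) (i , b)))
      ; emb-in   = λ a → cong proj₁ (strictlyInverseˡ (i , a))
      ; back     = λ p → proj₁ (project _ p)
      ; emb-back = λ p → trans (cong from (proj₂ (project _ p))) (strictlyInverseʳ _)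
      }

  buoy⇒InC : ∀ {k} → 1 ≤ k → BuoyConstruction k G → InC k G
  buoy⇒InC 1≤k (ks , B , 1≤ks , inC , edge , total , buoy) =
    CritOn⇒Critical self-embedding
      (buoy-critical ks 1≤k 1≤ks (λ i → Critical⇒CritOn (part? i) (bag-embedding i) (proj₁ (inC i))) edge total) ,
    Composition.composition-free G τ _≟_ c5Adj cross bag-embedding P5-buoy coP5-buoy (proj₂ ∘ inC)
    where
    open BuoyBackward buoy
    open BuoyPartition τ cross

-- Necessity of the two constructions

module Forward (G : Graph) (free : P5coP5Free G) where
  open Colouring G
  open CriticalParts G
  open Quotients G free

  module PartGraphs {I : Set} (τ : V → I) (_≟ᴵ_ : DecidableEquality I) where
    open PartColours τ _≟ᴵ_

    partGraph : I → Graph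
    partGraph i = part (part? i)

    partGraph-embedding : ∀ i → Embedding (partGraph i) (Part i)
    partGraph-embedding i = part-embedding (part? i)

    partGraph-InC : ∀ {k i} → CritOn (Part i) k → InC k (partGraph i)
    partGraph-InC {i = i} crit =
      CritOn⇒Critical (partGraph-embedding i) crit , Embedding-free (partGraph-embedding i) free

    module _ {i : I} where
      open Embedding (partGraph-embedding i) public

    back-emb : ∀ {i} {a : Fin (size (partGraph i))} (p : τ (emb a) ≡ i) → back p ≡ a
    back-emb p = emb-inj (emb-back p)

  join-construction : ∀ {k} → 1 ≤ k → CritOn All k → (τ : V → Bool) → (∀ b → ∃ λ v → τ v ≡ b) →
    (∀ u v → τ u ≢ τ v → adj G u v ≡ true) → JoinConstruction k G
  join-construction 1≤k crit τ nonempty cross =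
    let ks , 1≤ks , total , crits = join-parts 1≤k crit nonempty in
    ks true , ks false , 1≤ks true , 1≤ks false , total , partGraph true , partGraph false ,
    partGraph-InC (crits true) , partGraph-InC (crits false) ,
    mk↔ₛ′ to from to-from from-to ,
    λ u v → trans (cong₂ (adj G) (sym (from-to u)) (sym (from-to v))) (from-adj (to u) (to v))
    where
    open JoinPartition τ cross
    open PartGraphs τ Bool._≟_
    W : Set
    W = Fin (size (partGraph true)) ⊎ Fin (size (partGraph false))
    place : ∀ {v} b → τ v ≡ b → W
    place true  p = inj₁ (back p)
    place false p = inj₂ (back p)
    to : V → W
    to v = place (τ v) refl
    from : W → V
    from (inj₁ a) = emb a
    from (inj₂ a) = emb a
    from-place : ∀ {v} b (p : τ v ≡ b) → from (place b p) ≡ v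
    from-place true  p = emb-back p
    from-place false p = emb-back p
    from-to : ∀ v → from (to v) ≡ v
    from-to v = from-place (τ v) refl
    place-unique : ∀ {v} b (p : τ v ≡ b) → to v ≡ place b p
    place-unique b refl = refl
    to-from : ∀ x → to (from x) ≡ x
    to-from (inj₁ a) = trans (place-unique true (emb-in a)) (cong inj₁ (back-emb (emb-in a)))
    to-from (inj₂ a) = trans (place-unique false (emb-in a)) (cong inj₂ (back-emb (emb-in a)))
    from-adj : ∀ x y → adj G (from x) (from y) ≡ joinAdj (partGraph true) (partGraph false) x y
    from-adj (inj₁ a) (inj₁ b) = refl
    from-adj (inj₂ a) (inj₂ b) = refl
    from-adj (inj₁ a) (inj₂ b) = true-false (emb-in a) (emb-in b)
    from-adj (inj₂ a) (inj₁ b) = trans (adj-sym G _ _) (true-false (emb-in b) (emb-in a))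

  buoy-construction : ∀ {k} → 2 ≤ k → CritOn All k → BuoyOutcome → BuoyConstruction k G
  buoy-construction 2≤k crit (τ , nonempty , cross) =
    let ks , 1≤ks , crits , edge , total = buoy-parts 2≤k crit nonempty in
    ks , partGraph , 1≤ks , (λ i → partGraph-InC (crits i)) , edge , total ,
    (λ i → ≤-trans (s≤s z≤n) (toℕ<n (back (proj₂ (nonempty i))))) ,
    mk↔ₛ′ to from to-from from-to ,
    λ u v → trans (cong₂ (adj G) (sym (from-to u)) (sym (from-to v))) (from-adj (to u) (to v))
    where
    open BuoyPartition τ cross
    open PartGraphs τ _≟_
    to : V → BuoyVertex partGraph
    to v = τ v , back refl
    from : BuoyVertex partGraph → V
    from (i , a) = emb a
    from-to : ∀ v → from (to v) ≡ v
    from-to v = emb-back refl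
    to-unique : ∀ {v i} (p : τ v ≡ i) → to v ≡ (i , back p)
    to-unique refl = refl
    to-from : ∀ x → to (from x) ≡ x
    to-from (i , a) = trans (to-unique (emb-in a)) (cong (i ,_) (back-emb (emb-in a)))
    from-adj : ∀ x y → adj G (from x) (from y) ≡ buoyAdj partGraph x y
    from-adj (i , a) (j , b) with i ≟ j
    ... | yes refl = refl
    ... | no i≢j   = trans
      (cross _ _ λ eq → i≢j (trans (sym (emb-in a)) (trans eq (emb-in b))))
      (cong₂ c5Adj (emb-in a) (emb-in b))

  -- Starts the contraction at the partition into single vertices; with at most one vertex a single
  -- colour would do.
  two-vertices : ∀ {k} → 2 ≤ k → CritOn All k → Quotient.Nontrivial discrete
  two-vertices 2≤k (_ , minimal , _) = decidable-stable (any? λ u → any? λ v → ¬? (u ≟ v)) λ none →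
    minimal 1 2≤k ((λ _ → 0) , (λ _ _ → s≤s z≤n) , λ u v _ _ uv _ →
      none (u , v , λ { refl → contradiction (trans (sym uv) (adj-irr G u)) λ () }))

  construct : ∀ {k} → 2 ≤ k → Critical k G → JoinConstruction k G ⊎ BuoyConstruction k G
  construct 2≤k critical = [ inj₂ ∘ buoy-construction 2≤k crit , inj₁ ∘ perfect ]′
    (decompose discrete (two-vertices 2≤k crit))
    where
    crit = Critical⇒CritOn (λ _ → yes tt) self-embedding critical
    perfect : PerfectOutcome → JoinConstruction _ G
    perfect (q , nontrivial , noC5) =
      let τ , nonempty , cross = PerfectQuotient.join-partition G free q noC5 (<⇒≤ 2≤k) crit nontrivial
      in join-construction (<⇒≤ 2≤k) crit τ nonempty cross

theorem1 : (k : ℕ) → 2 ≤ k → (G : Graph) →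
    InC k G ⇔ (JoinConstruction k G ⊎ BuoyConstruction k G)
theorem1 k 2≤k G = mk⇔
  (λ (critical , free) → Forward.construct G free 2≤k critical)
  [ Backward.join⇒InC G , Backward.buoy⇒InC G (<⇒≤ 2≤k) ]′
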